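{- Let $G$ be a totally disconnected locally compact group with meet groupoid $\mathcal{W}=\mathcal{W}(G)$. Let $\mathcal{CSI}(\mathcal{W})$ be the set of closed-subgroup ideals of $\mathcal{W}$, with the subspace topology inherited from the product topology on the power set $\mathcal{P}(\mathcal{W})=\{0,1\}^{\mathcal{W}}$, and let $\mathcal{S}(G)$ be the Chabauty space of $G$. Then the map $\Gamma:\mathcal{CSI}(\mathcal{W})\to\mathcal{S}(G)$ given by $\mathcal{J}\mapsto S_{\mathcal{J}}=G\setminus\bigcup\mathcal{J}$ is a continuous bijection of compact spaces, and hence a homeomorphism.
   Context: $\mathcal{W}(G)$ has as its elements the compact open cosets in $G$ (cosets of compact open subgroups) together with $\emptyset$, with intersection as the meet operation. The product $A\cdot B$ of nonempty $A,B\in\mathcal{W}(G)$ is defined if and only if there is a subgroup $U$ such that $A$ is a left coset of $U$ and $B$ is a right coset of $U$; in that case $A\cdot B$ is the usual product of subsets of $G$. Also $\emptyset\cdot\emptyset=\emptyset$, and no other products involving $\emptyset$ are defined. The inverse is $A^{ -1}=\{g^{ -1}:g\in A\}$. A set $\mathcal{J}\subseteq\mathcal{W}$ is an ideal of $\mathcal{W}$ if $\emptyset\in\mathcal{J}$ and, whenever $B_1,\dots,B_n\in\mathcal{J}$, $A\in\mathcal{W}$ and $A\subseteq\bigcup_i B_i$, then $A\in\mathcal{J}$. A closed-subgroup ideal is an ideal $\mathcal{J}$ that is closed under inversion $A\mapsto A^{ -1}$ and such that for nonempty $A,B\in\mathcal{W}$, if $A\cdot B$ is defined and $A\cdot B\in\mathcal{J}$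 then $A\in\mathcal{J}$ or $B\in\mathcal{J}$. The Chabauty space $\mathcal{S}(G)$ is the set of closed subgroups of $G$ with the topology whose basic open sets are $\Omega(K;R_1,\dots,R_n)=\{U \text{ closed subgroup of } G: U\cap K=\emptyset \text{ and } U\cap R_i\neq\emptyset \text{ for all } i\le n\}$, for $K\subseteq G$ compact and $R_1,\dots,R_n\subseteq G$ open.
   Formalization: Closed-subgroup ideals are required to be proper (J ≠ W): the quoted definition admits J = W, for which G∖⋃J is empty and hence not a subgroup, so Γ would not map into S(G); only this one ideal is excluded. -}

module Defs where

open import Algebra.Bundles using (Group)
open import Data.Bool.Base using (Bool; true)
open import Data.List.Base using (List; []; _++_)
open import Data.List.Relation.Unary.All as All using (All; [])
import Data.List.Relation.Unary.All.Properties as All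
open import Data.List.Relation.Unary.Any using (Any)
import Data.List.Relation.Unary.Any.Properties as Any
open import Data.Product.Base using (Σ; Σ-syntax; ∃-syntax; _×_; _,_; proj₁; proj₂)
open import Data.Sum.Base using (_⊎_; inj₁; inj₂; [_,_])
import Data.Empty.Polymorphic as Empty
open import Data.Unit.Polymorphic.Base using (⊤)
open import Function.Bundles using (Func)
open import Function.Definitions using (Inverseᵇ)
import Function.Relation.Binary.Setoid.Equality as FunctionSpace
open import Level using (Level; _⊔_; suc)
open import Relation.Binary.Bundles using (Setoid)
open import Relation.Binary.Definitions using (_Respects_)
open import Relation.Binary.PropositionalEquality.Core as ≡ using (_≡_)
import Relation.Binary.PropositionalEquality.Properties as ≡
import Relation.Binary.Construct.On as On
open import Relation.Nullary.Negation.Core using (¬_)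
open import Relation.Unary
  using (Pred; _∈_; _⊆_; _≐_; _∩_; _∪_; ∅; ∁; ⋃; Satisfiable; _≬_; _⊥_)
import Relation.Unary.Properties as Pred

private variable
  a b ℓ ℓ′ p q s o o′ : Level

-- Subsets of a setoid are predicates respecting its equality.  For p at
-- least the level of the carrier, unions of families indexed by a set of
-- level p are arbitrary unions: a union V of open sets is also the union,
-- indexed by the points x of V, of some open U with x ∈ U ⊆ V.

record Topology (X : Setoid a ℓ) (p o : Level) : Set (a ⊔ ℓ ⊔ suc (p ⊔ o)) where
  open Setoid X
  field
    Open        : Pred (Pred Carrier p) o
    Open-resp-≈ : ∀ {U} → Open U → U Respects _≈_
    Open-resp-≐ : ∀ {U V} → U ≐ V → Open U → Open V
    Open-⊤      : Open (λ _ → ⊤)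
    Open-∩      : ∀ {U V} → Open U → Open V → Open (U ∩ V)
    Open-⋃      : (I : Set p) (U : I → Pred Carrier p) →
                  (∀ i → Open (U i)) → Open (⋃ I U)

  Closed : Pred (Pred Carrier p) o
  Closed C = Open (∁ C)

  Compact : Pred (Pred Carrier q) (a ⊔ suc p ⊔ o ⊔ q)
  Compact K = (I : Set p) (U : I → Pred Carrier p) → (∀ i → Open (U i)) →
              K ⊆ ⋃ I U →
              ∃[ is ] K ⊆ (λ x → Any (λ i → x ∈ U i) is)

  Hausdorff : Set (a ⊔ ℓ ⊔ suc p ⊔ o)
  Hausdorff = ∀ x y → ¬ (x ≈ y) →
              ∃[ U ] ∃[ V ] Open U × Open V × x ∈ U × y ∈ V × U ⊥ V

  LocallyCompact : Set (a ⊔ ℓ ⊔ suc p ⊔ o)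
  LocallyCompact = ∀ x → ∃[ U ] ∃[ K ]
    Open U × K Respects _≈_ × Compact {q = p} K × x ∈ U × U ⊆ K

  Connected : Pred (Pred Carrier p) (a ⊔ suc p ⊔ o)
  Connected C = ∀ {U V} → Open U → Open V → C ⊆ U ∪ V →
                C ≬ U → C ≬ V → ¬ ((C ∩ U) ⊥ V)

  TotallyDisconnected : Set (a ⊔ ℓ ⊔ suc p ⊔ o)
  TotallyDisconnected = ∀ {C} → C Respects _≈_ → Connected C →
                        ∀ {x y} → x ∈ C → y ∈ C → x ≈ y

  CompactHausdorffSpace : Set (a ⊔ ℓ ⊔ suc p ⊔ o)
  CompactHausdorffSpace = Compact {q = p} (λ _ → ⊤) × Hausdorff

module _ (X : Setoid a ℓ) where
  open Setoid X

  generated : ∀ p {B : Set b} (⟦_⟧ : B → Pred Carrier q) →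
              (∀ β → ⟦ β ⟧ Respects _≈_) →
              (∀ x → ∃[ β ] x ∈ ⟦ β ⟧) →
              (∀ β γ → ∃[ δ ] ⟦ δ ⟧ ≐ ⟦ β ⟧ ∩ ⟦ γ ⟧) →
              Topology X p (a ⊔ b ⊔ p ⊔ q)
  generated p ⟦_⟧ resp cover inter = record
    { Open        = λ V → ∀ x → x ∈ V → ∃[ β ] x ∈ ⟦ β ⟧ × ⟦ β ⟧ ⊆ V
    ; Open-resp-≈ = λ oU {x} x≈y x∈U →
        let β , x∈β , β⊆U = oU x x∈U in β⊆U (resp β x≈y x∈β)
    ; Open-resp-≐ = λ (U⊆V , V⊆U) oU x x∈V →
        let β , x∈β , β⊆U = oU x (V⊆U x∈V) in β , x∈β , λ y∈β → U⊆V (β⊆U y∈β)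
    ; Open-⊤      = λ x _ → let β , x∈β = cover x in β , x∈β , _
    ; Open-∩      = λ oU oV x (x∈U , x∈V) →
        let β , x∈β , β⊆U = oU x x∈U
            γ , x∈γ , γ⊆V = oV x x∈V
            δ , δ⊆ , ⊆δ   = inter β γ
        in δ , ⊆δ (x∈β , x∈γ) ,
           λ y∈δ → β⊆U (proj₁ (δ⊆ y∈δ)) , γ⊆V (proj₂ (δ⊆ y∈δ))
    ; Open-⋃      = λ I U oU x (i , x∈Ui) →
        let β , x∈β , β⊆U = oU i x x∈Ui in β , x∈β , λ y∈β → i , β⊆U y∈β
    }

  module _ (S : Pred Carrier s) where

    subsetoid : Setoid (a ⊔ s) ℓ
    subsetoid = On.setoid {B = Σ Carrier S} X proj₁

    subspace : Topology X p o → Topology subsetoid p (a ⊔ s ⊔ suc p ⊔ o)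
    subspace T = record
      { Open        = λ V → ∃[ U ] Open U × V ≐ (λ x → proj₁ x ∈ U)
      ; Open-resp-≈ = λ (U , oU , V⊆U , U⊆V) x≈y x∈V →
          U⊆V (Open-resp-≈ oU x≈y (V⊆U x∈V))
      ; Open-resp-≐ = λ V≐V′ (U , oU , V≐U) →
          U , oU , Pred.≐-trans (Pred.≐-sym V≐V′) V≐U
      ; Open-⊤      = (λ _ → ⊤) , Open-⊤ , _ , _
      ; Open-∩      = λ (U , oU , V⊆U , U⊆V) (U′ , oU′ , V′⊆U′ , U′⊆V′) →
          U ∩ U′ , Open-∩ oU oU′ ,
          (λ (x∈V , x∈V′) → V⊆U x∈V , V′⊆U′ x∈V′) ,
          (λ (x∈U , x∈U′) → U⊆V x∈U , U′⊆V′ x∈U′)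
      ; Open-⋃      = λ I V oV →
          ⋃ I (λ i → proj₁ (oV i)) ,
          Open-⋃ I (λ i → proj₁ (oV i)) (λ i → proj₁ (proj₂ (oV i))) ,
          (λ (i , x∈Vi) → i , proj₁ (proj₂ (proj₂ (oV i))) x∈Vi) ,
          (λ (i , x∈Ui) → i , proj₂ (proj₂ (proj₂ (oV i))) x∈Ui)
      }
      where open Topology T

Continuous : {X : Setoid a ℓ} {Y : Setoid b ℓ′} →
             Topology X p o → Topology Y p o′ → Func X Y → Set (b ⊔ suc p ⊔ o ⊔ o′)
Continuous T T′ f = ∀ V → Topology.Open T′ V → Topology.Open T (λ x → Func.to f x ∈ V)

Homeomorphism : {X : Setoid a ℓ} {Y : Setoid b ℓ′} →
                Topology X p o → Topology Y p o′ → Func X Y →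
                Set (a ⊔ b ⊔ ℓ ⊔ ℓ′ ⊔ suc p ⊔ o ⊔ o′)
Homeomorphism {X = X} {Y = Y} T T′ f =
  Continuous T T′ f ×
  Σ[ g ∈ Func Y X ] Continuous T′ T g ×
    Inverseᵇ (Setoid._≈_ X) (Setoid._≈_ Y) (Func.to f) (Func.to g)

-- Locally compact groups are Hausdorff by convention.

record TDLCGroup (c ℓ o : Level) : Set (suc (c ⊔ ℓ ⊔ o)) where
  field
    group    : Group c ℓ
  open Group group public
  field
    topology : Topology setoid (c ⊔ ℓ) o
  open Topology topology public
  field
    ∙-continuous : ∀ {W x y} → Open W → (x ∙ y) ∈ W →
                   ∃[ U ] ∃[ V ] Open U × Open V × x ∈ U × y ∈ V ×
                     (∀ {u v} → u ∈ U → v ∈ V → (u ∙ v) ∈ W)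
    ⁻¹-continuous : ∀ {U} → Open U → Open (λ x → (x ⁻¹) ∈ U)
    hausdorff           : Hausdorff
    locallyCompact      : LocallyCompact
    totallyDisconnected : TotallyDisconnected

module MeetGroupoid {c ℓ o} (G : TDLCGroup c ℓ o) where
  open TDLCGroup G

  Subset : Set (suc (c ⊔ ℓ))
  Subset = Pred Carrier (c ⊔ ℓ)

  -- The common level of the points of all spaces below.
  w : Level
  w = suc (c ⊔ ℓ) ⊔ o

  record IsSubgroup (U : Subset) : Set (c ⊔ ℓ) where
    field
      resp      : U Respects _≈_
      ε-closed  : ε ∈ U
      ∙-closed  : ∀ {x y} → x ∈ U → y ∈ U → (x ∙ y) ∈ U
      ⁻¹-closed : ∀ {x} → x ∈ U → (x ⁻¹) ∈ U

  _·_ : Subset → Subset → Subset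
  A · B = λ x → ∃[ y ] ∃[ z ] y ∈ A × z ∈ B × x ≈ y ∙ z

  _⁻¹ˢ : Subset → Subset
  A ⁻¹ˢ = λ x → ∃[ y ] y ∈ A × x ≈ y ⁻¹

  _LeftCosetOf_ _RightCosetOf_ : Subset → Subset → Set (c ⊔ ℓ)
  A LeftCosetOf  U = ∃[ g ] A ≐ (λ x → ∃[ u ] u ∈ U × x ≈ g ∙ u)
  A RightCosetOf U = ∃[ g ] A ≐ (λ x → ∃[ u ] u ∈ U × x ≈ u ∙ g)

  CompactOpenCoset : Pred Subset w
  CompactOpenCoset A = ∃[ U ] IsSubgroup U × Compact U × Open U ×
                              (A LeftCosetOf U ⊎ A RightCosetOf U)

  record 𝓦 : Set w where
    field
      set  : Subset
      elem : set ≐ ∅ ⊎ CompactOpenCoset set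
  open 𝓦 public

  𝓦-setoid : Setoid w (c ⊔ ℓ)
  𝓦-setoid = record
    { Carrier       = 𝓦
    ; _≈_           = λ A B → set A ≐ set B
    ; isEquivalence = record
      { refl = Pred.≐-refl ; sym = Pred.≐-sym ; trans = Pred.≐-trans } }

  -- Product A B C: the product of A and B is defined, with value C.
  -- Inverse A B: B is the inverse of A.  Both are given as relations, which
  -- avoids having to build the value as an element of 𝓦.
  Product : 𝓦 → 𝓦 → 𝓦 → Set (suc (c ⊔ ℓ))
  Product A B C =
    (set A ≐ ∅ × set B ≐ ∅ × set C ≐ ∅) ⊎
    (Satisfiable (set A) × Satisfiable (set B) ×
     (∃[ U ] IsSubgroup U × set A LeftCosetOf U × set B RightCosetOf U) ×
     set C ≐ set A · set B)

  Inverse : 𝓦 → 𝓦 → Set (c ⊔ ℓ)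
  Inverse A B = set B ≐ set A ⁻¹ˢ

  -- 𝒫(𝓦) = {0,1}^𝓦
  𝒫𝓦 : Setoid w w
  𝒫𝓦 = FunctionSpace.setoid 𝓦-setoid (≡.setoid Bool)

  infix 4 _∈ᴶ_
  _∈ᴶ_ : 𝓦 → Setoid.Carrier 𝒫𝓦 → Set
  A ∈ᴶ J = Func.to J A ≡ true

  -- Product topology on {0,1}^𝓦, {0,1} being discrete: a basic open set
  -- prescribes finitely many coordinates.
  Cylinder : List (𝓦 × Bool) → Pred (Setoid.Carrier 𝒫𝓦) w
  Cylinder abs J = All (λ (A , b) → Func.to J A ≡ b) abs

  𝒫𝓦-topology : Topology 𝒫𝓦 w w
  𝒫𝓦-topology = generated 𝒫𝓦 w Cylinder
    (λ abs J≈J′ → All.map λ {(A , _)} eq → ≡.trans (≡.sym (J≈J′ A)) eq)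
    (λ _ → [] , [])
    (λ abs abs′ → abs ++ abs′ , All.++⁻ abs , λ (h , h′) → All.++⁺ h h′)

  record IsIdeal (J : Setoid.Carrier 𝒫𝓦) : Set w where
    field
      ∅-mem    : ∀ A → set A ≐ ∅ → A ∈ᴶ J
      ∪-closed : ∀ Bs → All (_∈ᴶ J) Bs →
                 ∀ A → set A ⊆ (λ x → Any (λ B → x ∈ set B) Bs) → A ∈ᴶ J

  -- As for prime ideals, J = 𝓦 has to be excluded: it satisfies the other
  -- conditions, but the complement of its union is empty, so not a subgroup.
  record IsClosedSubgroupIdeal (J : Setoid.Carrier 𝒫𝓦) : Set w where
    field
      isIdeal   : IsIdeal J
      proper    : ¬ (∀ A → A ∈ᴶ J)
      ⁻¹-closed : ∀ A B → Inverse A B → A ∈ᴶ J → B ∈ᴶ J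
      prime     : ∀ A B C → Satisfiable (set A) → Satisfiable (set B) →
                  Product A B C → C ∈ᴶ J → A ∈ᴶ J ⊎ B ∈ᴶ J

  CSI : Setoid w w
  CSI = subsetoid 𝒫𝓦 IsClosedSubgroupIdeal

  CSI-topology : Topology CSI w (suc w)
  CSI-topology = subspace 𝒫𝓦 IsClosedSubgroupIdeal 𝒫𝓦-topology

  record ClosedSubgroup : Set w where
    field
      carrier    : Subset
      isSubgroup : IsSubgroup carrier
      closed     : Closed carrier
  open ClosedSubgroup public

  𝓢 : Setoid w (c ⊔ ℓ)
  𝓢 = record
    { Carrier       = ClosedSubgroup
    ; _≈_           = λ S T → carrier S ≐ carrier T
    ; isEquivalence = record
      { refl = Pred.≐-refl ; sym = Pred.≐-sym ; trans = Pred.≐-trans } }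

  record ΩIndex : Set w where
    field
      K         : Subset
      K-resp    : K Respects _≈_
      K-compact : Compact K
      Rs        : List Subset
      Rs-open   : All Open Rs

  Ω : ΩIndex → Pred ClosedSubgroup (suc (c ⊔ ℓ))
  Ω β S = (carrier S ⊥ K) × All (carrier S ≬_) Rs
    where open ΩIndex β

  Chabauty : Topology 𝓢 w w
  Chabauty = generated 𝓢 w Ω
    (λ _ (S⊆T , T⊆S) (S⊥K , S≬Rs) →
      (λ (x∈T , x∈K) → S⊥K (T⊆S x∈T , x∈K)) ,
      All.map (λ (x , x∈S , x∈R) → x , S⊆T x∈S , x∈R) S≬Rs)
    (λ S → record
      { K = λ _ → Empty.⊥ ; K-resp = λ _ () ; K-compact = λ _ _ _ _ → [] , λ ()
      ; Rs = [] ; Rs-open = [] } , (λ ()) , [])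
    (λ β γ → let open ΩIndex in record
      { K         = K β ∪ K γ
      ; K-resp    = λ x≈y → [ (λ h → inj₁ (K-resp β x≈y h)) , (λ h → inj₂ (K-resp γ x≈y h)) ]
      ; K-compact = λ I U oU K⊆U →
          let is , h  = K-compact β I U oU (λ x∈K → K⊆U (inj₁ x∈K))
              js , h′ = K-compact γ I U oU (λ x∈K → K⊆U (inj₂ x∈K))
          in is ++ js , [ (λ k → Any.++⁺ˡ (h k)) , (λ k → Any.++⁺ʳ is (h′ k)) ]
      ; Rs        = Rs β ++ Rs γ
      ; Rs-open   = All.++⁺ (Rs-open β) (Rs-open γ) } ,
      (λ (S⊥K , S≬Rs) →
        ((λ (s , k) → S⊥K (s , inj₁ k)) , All.++⁻ˡ (Rs β) S≬Rs) ,
        ((λ (s , k) → S⊥K (s , inj₂ k)) , All.++⁻ʳ (Rs β) S≬Rs)) ,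
      (λ ((S⊥K , S≬Rs) , (S⊥K′ , S≬Rs′)) →
        (λ { (s , inj₁ k) → S⊥K (s , k) ; (s , inj₂ k) → S⊥K′ (s , k) }) ,
        All.++⁺ S≬Rs S≬Rs′))

  -- S_J = G ∖ ⋃ J
  S⟨_⟩ : Setoid.Carrier CSI → Pred Carrier w
  S⟨ J , _ ⟩ = ∁ (λ x → ∃[ A ] A ∈ᴶ J × x ∈ set A)

{-# OPTIONS --safe #-}

-- Van Dantzig: for a compact neighbourhood K of ε, the intersection over all
-- symmetric neighbourhoods N of the N-chain components of ε in K is connected,
-- hence trivial; by compactness some component lies in a given neighbourhood
-- of ε, and for a smaller N it is a compact open subgroup.  So the compact
-- open cosets form a basis of G.  The inverse of Γ is S ↦ {A : A ∩ S = ∅}: both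
-- composites are the identity because a compact open coset contained in ⋃ J
-- lies in J, and the complement of a closed S is a union of such cosets.  For
-- Γ and its inverse, the condition A ∈ J on ideals corresponds to A ∩ S = ∅ on
-- subgroups, where A is both compact and open.  CSI is closed in {0,1}^𝓦, which
-- is compact by the Teichmüller–Tukey lemma.

module Submission where

open import Defs
open import Axiom.ExcludedMiddle using (ExcludedMiddle)
open import Axiom.Extensionality.Propositional using (Extensionality)
import Algebra.Properties.Group as GroupProperties
open import Data.Bool.Base using (Bool; true; false)
open import Data.Bool.Properties using (¬-not; not-¬; ⇔→≡)
open import Data.Empty using (⊥-elim)
import Data.Empty.Polymorphic as Empty
open import Data.List.Base as List using (List; []; _∷_; _++_)
import Data.List.Relation.Binary.Subset.Propositional as List
import Data.List.Relation.Binary.Subset.Propositional.Properties as List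
open import Data.List.Relation.Unary.All as All using (All; []; _∷_)
import Data.List.Relation.Unary.All.Properties as All
open import Data.List.Relation.Unary.Any as Any using (Any; here; there)
import Data.List.Relation.Unary.Any.Properties as Any
open import Data.Maybe.Base using (Maybe; just; nothing)
import Data.Maybe.Relation.Unary.Any as Maybe
open import Data.Product.Base using (Σ-syntax; ∃-syntax; _×_; _,_; proj₁; proj₂)
open import Data.Sum.Base using (_⊎_; inj₁; inj₂; [_,_]; [_,_]′)
open import Data.Unit.Polymorphic.Base using (⊤)
open import Function.Base using (_∘_; id)
open import Function.Bundles using (Func; mk⇔)
open import Function.Definitions using (Bijective; Inverseᵇ)
open import Level as Level using (Level; Lift; lift; lower; _⊔_)
open import Relation.Binary.Bundles using (Setoid)
open import Relation.Binary.Definitions using (_Respects_)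
open import Relation.Binary.PropositionalEquality as ≡ using (_≡_)
import Relation.Binary.Reasoning.Setoid as SetoidReasoning
open import Relation.Nullary using (¬_; yes; no; does)
open import Relation.Nullary.Decidable using (decidable-stable; dec-true; does-⇔; toSum)
open import Relation.Unary
  using (Pred; _∈_; _∉_; _⊆_; _≐_; _∩_; _∪_; ⋃; _≬_; _⊥_; Satisfiable)

private variable
  a b i p q ℓ ℓ′ o o′ : Level
  A : Set a
  B : Set b

-- Classical logic and Boolean truth values.

module Classical (em : ∀ {a} → ExcludedMiddle a) where

  stable : ¬ ¬ A → A
  stable = decidable-stable em

  ⌊_⌋ : Set a → Bool
  ⌊ A ⌋ = does (em {P = A})

  ⌊⌋⁺ : A → ⌊ A ⌋ ≡ true
  ⌊⌋⁺ = dec-true em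

  ⌊⌋⁻ : ⌊ A ⌋ ≡ true → A
  ⌊⌋⁻ {A = A} eq with em {P = A} | eq
  ... | yes x | _ = x

  ⌊⌋-cong : (A → B) → (B → A) → ⌊ A ⌋ ≡ ⌊ B ⌋
  ⌊⌋-cong f g = does-⇔ (mk⇔ f g) em em

  -- Propositional resizing.
  Small : ∀ p → Set a → Set p
  Small p A = Lift p (⌊ A ⌋ ≡ true)

  small : A → Small p A
  small x = lift (⌊⌋⁺ x)

  unsmall : Small p A → A
  unsmall = ⌊⌋⁻ ∘ lower

-- From the Bourbaki-Witt fixed point to compactness of two-valued assignments.

infix 4 _∈ᵇ_ _⊑_

-- Boolean values keep subsets of `A`, and families of such subsets, at the level of `A`; function
-- extensionality then turns mutual inclusion into equality.
_∈ᵇ_ : A → (A → Bool) → Set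
x ∈ᵇ s = s x ≡ true

_⊑_ : {A : Set a} → (A → Bool) → (A → Bool) → Set a
s ⊑ t = ∀ x → x ∈ᵇ s → x ∈ᵇ t

⊑-trans : {s t u : A → Bool} → s ⊑ t → t ⊑ u → s ⊑ u
⊑-trans p q x = q x ∘ p x

-- The Bourbaki–Witt argument: the sets reachable from ∅ by next and by unions
-- form a chain, whose union is therefore reachable and fixed by next.
module Tower
  (em : ∀ {a} → ExcludedMiddle a) (ext : ∀ {a b} → Extensionality a b)
  {Y : Set a} (next : (Y → Bool) → Y → Bool) (inflationary : ∀ s → s ⊑ next s)
  where
  open Classical em

  ⊑-antisym : {s t : Y → Bool} → s ⊑ t → t ⊑ s → s ≡ t
  ⊑-antisym p q = ext λ x → ⇔→≡ (mk⇔ (p x) (q x))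

  ⋁ : ((Y → Bool) → Bool) → Y → Bool
  ⋁ P y = ⌊ (∃[ s ] s ∈ᵇ P × y ∈ᵇ s) ⌋

  ⋁-upper : ∀ {P s} → s ∈ᵇ P → s ⊑ ⋁ P
  ⋁-upper s∈P y y∈s = ⌊⌋⁺ (_ , s∈P , y∈s)

  ⋁-least : ∀ {P t} → (∀ s → s ∈ᵇ P → s ⊑ t) → ⋁ P ⊑ t
  ⋁-least h y y∈⋁ = let s , s∈P , y∈s = ⌊⌋⁻ y∈⋁ in h s s∈P y y∈s

  -- The empty set arises as `sup` of the empty family.
  data Reached : Pred (Y → Bool) a where
    step : ∀ {s} → Reached s → Reached (next s)
    sup  : ∀ P → (∀ s → s ∈ᵇ P → Reached s) → Reached (⋁ P)

  Extreme : Pred (Y → Bool) a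
  Extreme e = ∀ {t} → Reached t → t ⊑ e → ¬ (e ⊑ t) → next t ⊑ e

  -- Induction on the construction of `t`. A step from below `e` stays below by extremality, unless
  -- it starts at `e` itself. A union has a member above `next e`, or all its members lie below `e`.
  compare : ∀ {e t} → Extreme e → Reached t → t ⊑ e ⊎ next e ⊑ t
  compare {e} x (step {s} r) with compare x r
  ... | inj₂ q = inj₂ (⊑-trans {s = next e} q (inflationary s))
  ... | inj₁ q with em {P = e ⊑ s}
  ...   | no e⋢s = inj₁ (x r q e⋢s)
  ...   | yes e⊑s with ≡.refl ← ⊑-antisym {e} {s} e⊑s q = inj₂ λ _ → id
  compare {e} x (sup P r) with em {P = ∃[ s ] s ∈ᵇ P × next e ⊑ s}
  ... | yes (s , s∈P , q) = inj₂ (⊑-trans {s = next e} q (⋁-upper s∈P))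
  ... | no none = inj₁ (⋁-least λ s s∈P →
    [ id , (λ q → ⊥-elim (none (s , s∈P , q))) ] (compare x (r s s∈P)))

  -- Induction on the construction of `e`. Strictly below a successor `next s`, the set `t` is
  -- either strictly below `s`, where the induction hypothesis applies, or equal to `s`. Strictly
  -- below a union, some member `s` has `next s` not contained in `t`, so `t` lies below `s`.
  extreme : ∀ {e} → Reached e → Extreme e
  extreme (step {s} r) {t} rt t⊑e e⋢t with compare (extreme r) rt
  ... | inj₂ q = ⊥-elim (e⋢t q)
  ... | inj₁ q with em {P = s ⊑ t}
  ...   | no s⋢t = ⊑-trans {s = next t} (extreme r rt q s⋢t) (inflationary s)
  ...   | yes s⊑t with ≡.refl ← ⊑-antisym {s} {t} s⊑t q = λ _ → id
  extreme (sup P r) {t} rt t⊑e e⋢t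
    with em {P = ∃[ s ] s ∈ᵇ P × ¬ (next s ⊑ t)}
  ... | no none = ⊥-elim (e⋢t (⋁-least λ s s∈P →
    ⊑-trans {s = s} (inflationary s) (stable λ n → none (s , s∈P , n))))
  ... | yes (s , s∈P , n) with compare (extreme (r s s∈P)) rt
  ...   | inj₂ q = ⊥-elim (n q)
  ...   | inj₁ q with em {P = s ⊑ t}
  ...     | no s⋢t = ⊑-trans {s = next t} (extreme (r s s∈P) rt q s⋢t) (⋁-upper s∈P)
  -- Here `t` is the member `s` itself; the union is not contained in it, so by comparability the
  -- union contains `next s`.
  ...     | yes s⊑t with ≡.refl ← ⊑-antisym {s} {t} s⊑t q
            with compare (extreme (r s s∈P)) (sup P r)
  ...       | inj₁ ⋁⊑s = ⊥-elim (e⋢t ⋁⊑s)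
  ...       | inj₂ next⊑⋁ = next⊑⋁

  total : ∀ {s t} → Reached s → Reached t → s ⊑ t ⊎ t ⊑ s
  total {s} r r′ with compare (extreme r) r′
  ... | inj₁ t⊑s = inj₂ t⊑s
  ... | inj₂ q   = inj₁ (⊑-trans {s = s} (inflationary s) q)

  top : Y → Bool
  top = ⋁ (λ s → ⌊ Reached s ⌋)

  top-reached : Reached top
  top-reached = sup _ (λ s → ⌊⌋⁻)

  top-fixed : next top ⊑ top
  top-fixed = ⋁-upper (⌊⌋⁺ (step top-reached))

-- The Teichmüller–Tukey lemma.
module MaximalConsistent
  (em : ∀ {a} → ExcludedMiddle a) (ext : ∀ {a b} → Extensionality a b)
  {Y : Set a} (Con : Pred (List Y) b) (Con-[] : Con [])
  where
  open Classical em

  Consistent : Pred (Y → Bool) (a ⊔ b)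
  Consistent s = ∀ ys → All (_∈ᵇ s) ys → Con ys

  insert : Y → (Y → Bool) → Y → Bool
  insert y s z = ⌊ (z ≡ y ⊎ z ∈ᵇ s) ⌋

  Extensible : Pred (Y → Bool) (a ⊔ b)
  Extensible s = ∃[ y ] ¬ (y ∈ᵇ s) × Consistent (insert y s)

  -- Deciding the Σ-type `Extensible s` also supplies a particular new element, so excluded middle
  -- acts as the choice function.
  next : (Y → Bool) → Y → Bool
  next s with em {P = Extensible s}
  ... | yes (y , _) = insert y s
  ... | no _        = s

  next-inflationary : ∀ s → s ⊑ next s
  next-inflationary s z z∈s with em {P = Extensible s}
  ... | yes _ = ⌊⌋⁺ (inj₂ z∈s)
  ... | no _  = z∈s

  next-consistent : ∀ {s} → Consistent s → Consistent (next s)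
  next-consistent {s} con with em {P = Extensible s}
  ... | yes (_ , _ , con′) = con′
  ... | no _               = con

  next-fixed : ∀ {s} → next s ⊑ s → ¬ Extensible s
  next-fixed {s} fix e with em {P = Extensible s}
  ... | yes (y , y∉s , _) = y∉s (fix y (⌊⌋⁺ (inj₁ ≡.refl)))
  ... | no n              = n e

  open Tower em ext next next-inflationary

  -- Reached sets form a chain, so the largest of finitely many members contains all the listed
  -- elements. The list is nonempty because `P` may be the empty family.
  ⋁-finite : ∀ P → (∀ s → s ∈ᵇ P → Reached s) → ∀ y ys → All (_∈ᵇ ⋁ P) (y ∷ ys) →
             ∃[ s ] s ∈ᵇ P × All (_∈ᵇ s) (y ∷ ys)
  ⋁-finite P r y [] (y∈⋁ ∷ []) = let s , s∈P , y∈s = ⌊⌋⁻ y∈⋁ in s , s∈P , y∈s ∷ []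
  ⋁-finite P r y (z ∷ zs) (y∈⋁ ∷ zs⊆⋁)
    with s , s∈P , y∈s ← ⌊⌋⁻ y∈⋁ | t , t∈P , zs⊆t ← ⋁-finite P r z zs zs⊆⋁
    with total (r s s∈P) (r t t∈P)
  ... | inj₁ s⊑t = t , t∈P , s⊑t y y∈s ∷ zs⊆t
  ... | inj₂ t⊑s = s , s∈P , y∈s ∷ All.map (t⊑s _) zs⊆t

  reached-consistent : ∀ {s} → Reached s → Consistent s
  reached-consistent (step r) = next-consistent (reached-consistent r)
  reached-consistent (sup P r) []       _ = Con-[]
  reached-consistent (sup P r) (y ∷ ys) h =
    let s , s∈P , h′ = ⋁-finite P r y ys h in reached-consistent (r s s∈P) (y ∷ ys) h′

  maximal : ∃[ s ] Consistent s × ¬ Extensible s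
  maximal = top , reached-consistent top-reached , next-fixed top-fixed

  -- Collecting all occurrences of `y` into one lets a failure of consistency after insertion be
  -- blamed on `y` together with finitely many elements of `s`.
  insert-split : ∀ {y s} ys → All (_∈ᵇ insert y s) ys →
                 ∃[ zs ] All (_∈ᵇ s) zs × ys List.⊆ y ∷ zs
  insert-split [] [] = [] , [] , λ ()
  insert-split (x ∷ ys) (x∈ ∷ h) with insert-split ys h | ⌊⌋⁻ x∈
  ... | zs , zs⊆s , ys⊆ | inj₁ x≡y = zs , zs⊆s ,
    λ { (here eq) → here (≡.trans eq x≡y) ; (there i) → ys⊆ i }
  ... | zs , zs⊆s , ys⊆ | inj₂ x∈s = x ∷ zs , x∈s ∷ zs⊆s ,
    λ { (here eq) → there (here eq)
      ; (there i) → List.++⁺ʳ (_ ∷ []) there (ys⊆ i) }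

-- Compactness of {0,1}^X; Con stands for the lists of conditions whose
-- cylinder has no finite subcover.
module TwoValued
  (em : ∀ {a} → ExcludedMiddle a) (ext : ∀ {a b} → Extensionality a b)
  {X : Set a} (Con : Pred (List (X × Bool)) b) (Con-[] : Con [])
  (Con-⊆ : ∀ {xs ys} → xs List.⊆ ys → Con ys → Con xs)
  (Con-split : ∀ {xs} x → Con xs → ∃[ c ] Con ((x , c) ∷ xs))
  where
  open Classical em
  open MaximalConsistent em ext Con Con-[]

  private
    m = proj₁ maximal

    inconsistent : ∀ y → ¬ (y ∈ᵇ m) → ∃[ zs ] All (_∈ᵇ m) zs × ¬ Con (y ∷ zs)
    inconsistent y y∉m = stable λ none → proj₂ (proj₂ maximal)
      (y , y∉m , λ ys h → let zs , zs⊆m , ys⊆ = insert-split ys h in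
        Con-⊆ ys⊆ (stable λ ¬con → none (zs , zs⊆m , ¬con)))

    -- If both values were rejected by the maximal set, the two finite lists refuting them could be
    -- joined; the join is consistent, and splitting it on `x` contradicts one of the refutations.
    decided : ∀ x → ∃[ c ] (x , c) ∈ᵇ m
    decided x = stable λ none →
      let ys , ys⊆m , ¬ys = inconsistent (x , true)  (λ h → none (_ , h))
          zs , zs⊆m , ¬zs = inconsistent (x , false) (λ h → none (_ , h))
      in refute ¬ys ¬zs (Con-split x (proj₁ (proj₂ maximal) (ys ++ zs) (All.++⁺ ys⊆m zs⊆m)))
      where
      refute : ∀ {ys zs} → ¬ Con ((x , true) ∷ ys) → ¬ Con ((x , false) ∷ zs) →
               ¬ (∃[ c ] Con ((x , c) ∷ ys ++ zs))
      refute ¬ys ¬zs (true  , con) = ¬ys (Con-⊆ (List.∷⁺ʳ _ (List.xs⊆xs++ys _ _)) con)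
      refute ¬ys ¬zs (false , con) = ¬zs (Con-⊆ (List.∷⁺ʳ _ (List.xs⊆ys++xs _ _)) con)

  assignment : X → Bool
  assignment x = proj₁ (decided x)

  assignment-consistent : ∀ xs → All (λ (x , c) → assignment x ≡ c) xs → Con xs
  assignment-consistent xs h =
    proj₁ (proj₂ maximal) xs (All.map (λ { {x , _} ≡.refl → proj₂ (decided x) }) h)

-- Neighbourhoods and compactness in a topological group.

module TopologicalGroup (em : ∀ {a} → ExcludedMiddle a) {c ℓ o} (G : TDLCGroup c ℓ o) where
  open Classical em
  open TDLCGroup G
  open MeetGroupoid G using (Subset; IsSubgroup)
  open GroupProperties group using
    (\\-leftDividesˡ; //-rightDividesʳ; ⁻¹-involutive; ⁻¹-anti-homo-∙; ε⁻¹≈ε)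
  open SetoidReasoning setoid hiding (start)

  -- The union is indexed by the points of `V`, which keeps the index type at the level allowed by
  -- `Open-⋃`.
  Open-local : ∀ {V : Subset} → (∀ {x} → x ∈ V → ∃[ U ] Open U × x ∈ U × U ⊆ V) → Open V
  Open-local {V} nbhd = Open-resp-≐
    ( (λ ((_ , x∈V) , y∈U) → proj₂ (proj₂ (proj₂ (nbhd x∈V))) y∈U)
    , (λ {x} x∈V → (x , x∈V) , proj₁ (proj₂ (proj₂ (nbhd x∈V)))) )
    (Open-⋃ (∃[ x ] x ∈ V) (λ (_ , x∈V) → proj₁ (nbhd x∈V)) (λ (_ , x∈V) → proj₁ (proj₂ (nbhd x∈V))))

  Open-∙ˡ : ∀ {U} g → Open U → Open (λ x → (g ∙ x) ∈ U)
  Open-∙ˡ g oU = Open-local λ gx∈U →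
    let _ , V , _ , oV , g∈ , x∈V , h = ∙-continuous oU gx∈U in V , oV , x∈V , h g∈

  Open-∙ʳ : ∀ {U} g → Open U → Open (λ x → (x ∙ g) ∈ U)
  Open-∙ʳ g oU = Open-local λ xg∈U →
    let V , _ , oV , _ , x∈V , g∈ , h = ∙-continuous oU xg∈U in V , oV , x∈V , λ y∈V → h y∈V g∈

  -- Covers by families of any level: choose a member for each point of K.
  finiteSubcover : ∀ {K : Subset} {I : Set i} → Compact K → (U : I → Subset) →
                   (∀ i → Open (U i)) → K ⊆ ⋃ I U →
                   ∃[ is ] K ⊆ (λ x → Any (λ i → x ∈ U i) is)
  finiteSubcover {K = K} compact U oU K⊆⋃ =
    let xs , K⊆ = compact (∃[ x ] x ∈ K) (U ∘ index) (oU ∘ index)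
                    (λ {x} x∈K → (x , x∈K) , proj₂ (K⊆⋃ x∈K))
    in List.map index xs , Any.map⁺ ∘ K⊆
    where
    index : (∃[ x ] x ∈ K) → _
    index (_ , x∈K) = proj₁ (K⊆⋃ x∈K)

  -- A cover of `C` becomes one of `K` when separating neighbourhoods of the points of `K` outside
  -- `C` are added; these miss `C` and are dropped from the finite subcover.
  Compact-closed : ∀ {K C : Subset} → Compact K → C ⊆ K →
                   (∀ {x} → x ∈ K → x ∉ C → ∃[ U ] Open U × x ∈ U × C ⊥ U) → Compact C
  Compact-closed {K} {C} compact C⊆K avoid I U oU C⊆⋃ =
    let js , K⊆ = finiteSubcover compact V oV λ x∈K → cover x∈K em
    in List.mapMaybe inside js ,
       λ x∈C → Any.mapMaybe⁺ _ js (Any.map⁺ (Any.map (λ {j} → select x∈C j) (K⊆ (C⊆K x∈C))))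
    where
    Outside = ∃[ x ] Σ[ x∈K ∈ x ∈ K ] x ∉ C

    V : I ⊎ Outside → Subset
    V (inj₁ i)               = U i
    V (inj₂ (_ , x∈K , x∉C)) = proj₁ (avoid x∈K x∉C)

    oV : ∀ j → Open (V j)
    oV (inj₁ i)               = oU i
    oV (inj₂ (_ , x∈K , x∉C)) = proj₁ (proj₂ (avoid x∈K x∉C))

    cover : ∀ {x} → x ∈ K → _ → x ∈ ⋃ _ V
    cover x∈K (yes x∈C) = let i , x∈U = C⊆⋃ x∈C in inj₁ i , x∈U
    cover x∈K (no x∉C)  = inj₂ (_ , x∈K , x∉C) , proj₁ (proj₂ (proj₂ (avoid x∈K x∉C)))

    inside : I ⊎ Outside → Maybe I
    inside = [ just , (λ _ → nothing) ]

    select : ∀ {x} → x ∈ C → ∀ j → x ∈ V j → Maybe.Any (λ i → x ∈ U i) (inside j)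
    select x∈C (inj₁ i)               x∈U = Maybe.just x∈U
    select x∈C (inj₂ (_ , x∈K , x∉C)) x∈U = ⊥-elim (proj₂ (proj₂ (proj₂ (avoid x∈K x∉C))) (x∈C , x∈U))

  record SymmetricNbhd : Set (Level.suc (c ⊔ ℓ) ⊔ o) where
    field
      nbhd      : Subset
      nbhd-open : Open nbhd
      ε∈nbhd    : ε ∈ nbhd
      nbhd-⁻¹   : ∀ {x} → x ∈ nbhd → (x ⁻¹) ∈ nbhd
  open SymmetricNbhd

  symmetrise : ∀ {U} → Open U → ε ∈ U → ∃[ N ] nbhd N ⊆ U
  symmetrise {U} oU ε∈U = record
    { nbhd      = λ x → x ∈ U × (x ⁻¹) ∈ U
    ; nbhd-open = Open-∩ oU (⁻¹-continuous oU)
    ; ε∈nbhd    = ε∈U , Open-resp-≈ oU (sym ε⁻¹≈ε) ε∈U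
    ; nbhd-⁻¹   = λ (x∈U , x⁻¹∈U) → x⁻¹∈U , Open-resp-≈ oU (sym (⁻¹-involutive _)) x∈U
    } , proj₁

  infixr 7 _⊓_

  _⊓_ : SymmetricNbhd → SymmetricNbhd → SymmetricNbhd
  M ⊓ N = record
    { nbhd      = nbhd M ∩ nbhd N
    ; nbhd-open = Open-∩ (nbhd-open M) (nbhd-open N)
    ; ε∈nbhd    = ε∈nbhd M , ε∈nbhd N
    ; nbhd-⁻¹   = λ (m , n) → nbhd-⁻¹ M m , nbhd-⁻¹ N n
    }

  everything : SymmetricNbhd
  everything = record
    { nbhd = λ _ → ⊤ ; nbhd-open = Open-⊤ ; ε∈nbhd = _ ; nbhd-⁻¹ = _ }

  ⨅ : {I : Set i} → (I → SymmetricNbhd) → List I → SymmetricNbhd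
  ⨅ N []       = everything
  ⨅ N (i ∷ is) = N i ⊓ ⨅ N is

  ⨅-lookup : ∀ {I : Set i} (N : I → SymmetricNbhd) {P : Pred I q} {is} →
             Any P is → ∃[ i ] P i × nbhd (⨅ N is) ⊆ nbhd (N i)
  ⨅-lookup N (here p)  = _ , p , proj₁
  ⨅-lookup N (there a) = let i , p , h = ⨅-lookup N a in i , p , h ∘ proj₂

  halve : ∀ M → ∃[ N ] nbhd N ⊆ nbhd M × (∀ {x y} → x ∈ nbhd N → y ∈ nbhd N → (x ∙ y) ∈ nbhd M)
  halve M =
    let U , V , oU , oV , ε∈U , ε∈V , h =
          ∙-continuous (nbhd-open M) (Open-resp-≈ (nbhd-open M) (sym (identityˡ ε)) (ε∈nbhd M))
        N , N⊆ = symmetrise (Open-∩ oU oV) (ε∈U , ε∈V)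
    in N ,
       (λ x∈N → Open-resp-≈ (nbhd-open M) (identityʳ _) (h (proj₁ (N⊆ x∈N)) ε∈V)) ,
       (λ x∈N y∈N → h (proj₁ (N⊆ x∈N)) (proj₂ (N⊆ y∈N)))

  translate : Carrier → SymmetricNbhd → Subset
  translate x N z = (x ⁻¹ ∙ z) ∈ nbhd N

  translate-open : ∀ x N → Open (translate x N)
  translate-open x N = Open-∙ˡ (x ⁻¹) (nbhd-open N)

  ∈-translate : ∀ x N → x ∈ translate x N
  ∈-translate x N = Open-resp-≈ (nbhd-open N) (sym (inverseˡ x)) (ε∈nbhd N)

  -- The product set of `S` and `N`.
  thickening : SymmetricNbhd → Subset → Subset
  thickening N S z = ∃[ x ] x ∈ S × z ∈ translate x N

  thickening-open : ∀ N S → Open (thickening N S)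
  thickening-open N S = Open-local λ (x , x∈S , z∈xN) →
    translate x N , translate-open x N , z∈xN , λ y∈xN → x , x∈S , y∈xN

  -- Compactness makes local bounds on the size of a neighbourhood uniform.
  uniform : ∀ {K : Subset} (P : SymmetricNbhd → Pred Carrier q) →
            (∀ {M N z} → nbhd M ⊆ nbhd N → z ∈ P N → z ∈ P M) → Compact K →
            (∀ {x} → x ∈ K → ∃[ N ] ∃[ U ] Open U × x ∈ U × (∀ {z} → z ∈ U → z ∈ P N)) →
            ∃[ N ] (∀ {z} → z ∈ K → z ∈ P N)
  uniform {K = K} P anti compact local =
    let xs , K⊆ = finiteSubcover {I = ∃[ x ] x ∈ K} compact
                    (λ (_ , x∈K) → proj₁ (proj₂ (local x∈K)))
                    (λ (_ , x∈K) → proj₁ (proj₂ (proj₂ (local x∈K))))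
                    (λ x∈K → (_ , x∈K) , proj₁ (proj₂ (proj₂ (proj₂ (local x∈K)))))
    in ⨅ N xs , λ z∈K → let (_ , x∈K) , z∈U , ⊆N = ⨅-lookup N (K⊆ z∈K) in
         anti ⊆N (proj₂ (proj₂ (proj₂ (proj₂ (local x∈K)))) z∈U)
    where
    N : (∃[ x ] x ∈ K) → SymmetricNbhd
    N (_ , x∈K) = proj₁ (local x∈K)

  -- Continuity of multiplication at `(x , ε)` gives a suitable neighbourhood near each `x` in `K`,
  -- and `uniform` makes the choice independent of `x`.
  thicken : ∀ {K O : Subset} → Compact K → Open O → K ⊆ O →
            ∃[ N ] (∀ {x} → x ∈ K → ∀ {v} → v ∈ nbhd N → (x ∙ v) ∈ O)
  thicken {K} {O} compact oO K⊆O =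
    uniform (λ N z → ∀ {v} → v ∈ nbhd N → (z ∙ v) ∈ O) (λ M⊆N h → h ∘ M⊆N) compact λ {x} x∈K →
      let U , V , oU , oV , x∈U , ε∈V , h =
            ∙-continuous oO (Open-resp-≈ oO (sym (identityʳ x)) (K⊆O x∈K))
          N , N⊆V = symmetrise oV ε∈V
      in N , U , oU , x∈U , λ z∈U v∈N → h z∈U (N⊆V v∈N)

  -- Chain components and the connectedness of their intersection.

  data Chain (K : Subset) (N : SymmetricNbhd) : Subset where
    start : ∀ {x} → x ≈ ε → Chain K N x
    step  : ∀ {x y v} → Chain K N x → v ∈ nbhd N → y ∈ K → y ≈ x ∙ v → Chain K N y

  Chain-resp : ∀ {K N} → K Respects _≈_ → Chain K N Respects _≈_
  Chain-resp K-resp x≈y (start x≈ε) = start (trans (sym x≈y) x≈ε)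
  Chain-resp K-resp x≈y (step ch v∈N x∈K x≈) = step ch v∈N (K-resp x≈y x∈K) (trans (sym x≈y) x≈)

  Chain-mono : ∀ {K M N} → nbhd M ⊆ nbhd N → Chain K M ⊆ Chain K N
  Chain-mono M⊆N (start x≈ε)          = start x≈ε
  Chain-mono M⊆N (step ch v∈M x∈K x≈) = step (Chain-mono M⊆N ch) (M⊆N v∈M) x∈K x≈

  module Chains {K : Subset} (compact : Compact K) (K-resp : K Respects _≈_) (ε∈K : ε ∈ K) where

    Chain⊆K : ∀ {N} → Chain K N ⊆ K
    Chain⊆K (start x≈ε)      = K-resp (sym x≈ε) ε∈K
    Chain⊆K (step _ _ x∈K _) = x∈K

    -- If the translate met the component, the symmetry of `N` would allow one more step, from the
    -- common point to `x`.
    Chain-avoid : ∀ {x N} → x ∈ K → x ∉ Chain K N → Chain K N ⊥ translate x N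
    Chain-avoid {x} {N} x∈K x∉ch {z} (ch , z∈xN) =
      x∉ch (step ch (nbhd-⁻¹ N z∈xN) x∈K (begin
        x                      ≈⟨ //-rightDividesʳ (x ⁻¹ ∙ z) x ⟨
        (x ∙ (x ⁻¹ ∙ z)) ∙ (x ⁻¹ ∙ z) ⁻¹ ≈⟨ ∙-congʳ (\\-leftDividesˡ x z) ⟩
        z ∙ (x ⁻¹ ∙ z) ⁻¹      ∎))

    Chain-compact : ∀ N → Compact (Chain K N)
    Chain-compact N = Compact-closed compact Chain⊆K λ {x} x∈K x∉ch →
      translate x N , translate-open x N , ∈-translate x N , Chain-avoid {N = N} x∈K x∉ch

    -- The quantification over neighbourhoods lives in a higher universe; `Small` lowers it to the
    -- level of `Subset`, at which total disconnectedness is stated.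
    Core : Subset
    Core x = Small (c ⊔ ℓ) (∀ N → Chain K N x)

    Core⊆Chain : ∀ N → Core ⊆ Chain K N
    Core⊆Chain N x∈Q = unsmall x∈Q N

    ε∈Core : ε ∈ Core
    ε∈Core = small λ _ → start refl

    Core-resp : Core Respects _≈_
    Core-resp x≈y x∈Q = small λ N → Chain-resp K-resp x≈y (unsmall x∈Q N)

    ∉Core : ∀ {x} → x ∉ Core → ∃[ N ] x ∉ Chain K N
    ∉Core x∉Q = stable λ none → x∉Q (small λ N → stable λ x∉ → none (N , x∉))

    -- Each point of `K` outside `Core` has a neighbourhood missed by some chain component, and the
    -- points of `Core` have the neighbourhood `O`; compactness of `K` yields one step size for all.
    shrink : ∀ {O} → Open O → Core ⊆ O → ∃[ N ] Chain K N ⊆ O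
    shrink {O} oO Q⊆O =
      let N , h = uniform (λ N z → z ∈ Chain K N → z ∈ O) (λ {M} {N} M⊆N h → h ∘ Chain-mono M⊆N)
                    compact (λ x∈K → local x∈K em)
      in N , λ z∈ch → h (Chain⊆K z∈ch) z∈ch
      where
      local : ∀ {x} → x ∈ K → _ → ∃[ N ] ∃[ U ] Open U × x ∈ U × (∀ {z} → z ∈ U → z ∈ Chain K N → z ∈ O)
      local x∈K (yes x∈Q) = everything , O , oO , Q⊆O x∈Q , λ z∈O _ → z∈O
      local {x} x∈K (no x∉Q) = let N , x∉ch = ∉Core x∉Q in
        N , translate x N , translate-open x N , ∈-translate x N ,
        λ z∈xN z∈ch → ⊥-elim (Chain-avoid {N = N} x∈K x∉ch (z∈ch , z∈xN))

    -- Steps of size N cannot leave Core ∩ A for the rest of Core if A contains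
    -- everything within three steps of Core ∩ A.
    no-jump : ∀ {A L N} → Open A → ε ∈ A →
              (∀ {q} → q ∈ Core ∩ A → ∀ {u v w} → u ∈ nbhd N → v ∈ nbhd N → w ∈ nbhd N →
               (q ∙ ((u ∙ v) ∙ w)) ∈ A) →
              Chain K L ⊆ thickening N Core → Chain K (L ⊓ N) ⊆ thickening N (Core ∩ A)
    no-jump {N = N} oA ε∈A gap L⊆ (start z≈ε) = ε , (ε∈Core , ε∈A) ,
      Open-resp-≈ (translate-open ε N) (sym z≈ε) (∈-translate ε N)
    no-jump {N = N} oA ε∈A gap L⊆ {z} zch@(step {x} {v = v} ch (_ , v∈N) _ z≈xv) =
      let q₁ , q₁∈Q∩A , x∈q₁N = no-jump oA ε∈A gap L⊆ ch
          q₂ , q₂∈Q , z∈q₂N = L⊆ (Chain-mono proj₁ zch)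
          v₁ = q₁ ⁻¹ ∙ x
          v₂ = q₂ ⁻¹ ∙ z
          -- From x = q₁v₁, z = xv and z = q₂v₂ follows q₂ = q₁v₁vv₂⁻¹, three steps away from q₁.
          q₂∈A = Open-resp-≈ oA (begin
            q₁ ∙ ((v₁ ∙ v) ∙ v₂ ⁻¹) ≈⟨ assoc q₁ _ _ ⟨
            (q₁ ∙ (v₁ ∙ v)) ∙ v₂ ⁻¹ ≈⟨ ∙-congʳ (assoc q₁ v₁ v) ⟨
            ((q₁ ∙ v₁) ∙ v) ∙ v₂ ⁻¹ ≈⟨ ∙-congʳ (∙-congʳ (\\-leftDividesˡ q₁ x)) ⟩
            (x ∙ v) ∙ v₂ ⁻¹         ≈⟨ ∙-congʳ z≈xv ⟨
            z ∙ v₂ ⁻¹               ≈⟨ ∙-congʳ (\\-leftDividesˡ q₂ z) ⟨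
            (q₂ ∙ v₂) ∙ v₂ ⁻¹       ≈⟨ //-rightDividesʳ v₂ q₂ ⟩
            q₂                      ∎)
            (gap q₁∈Q∩A x∈q₁N v∈N (nbhd-⁻¹ N z∈q₂N))
      in q₂ , (q₂∈Q , q₂∈A) , z∈q₂N

    -- The set is relatively closed in `K`: a point of `Core` outside `A` lies in the open set `B`,
    -- which is disjoint from it, and a point outside `Core` is separated from a chain component.
    Core∩-compact : {A B : Subset} → Open B → Core ⊆ A ∪ B → (Core ∩ A) ⊥ B → Compact (Core ∩ A)
    Core∩-compact {A} {B} oB Q⊆A∪B disjoint =
      Compact-closed compact (Chain⊆K ∘ Core⊆Chain everything ∘ proj₁) λ x∈K x∉ → avoid x∈K x∉ em
      where
      avoid : ∀ {x} → x ∈ K → x ∉ Core ∩ A → _ → ∃[ U ] Open U × x ∈ U × (Core ∩ A) ⊥ U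
      avoid x∈K x∉ (yes x∈Q) =
        B , oB , [ (λ x∈A → ⊥-elim (x∉ (x∈Q , x∈A))) , id ] (Q⊆A∪B x∈Q) , disjoint
      avoid {x} x∈K x∉ (no x∉Q) = let N , x∉ch = ∉Core x∉Q in
        translate x N , translate-open x N , ∈-translate x N ,
        λ ((y∈Q , _) , y∈xN) → Chain-avoid {N = N} x∈K x∉ch (Core⊆Chain N y∈Q , y∈xN)

    -- A point `b` of `Core` in `B` is joined to `ε` by chains of every step size. Sufficiently fine
    -- chains stay near `Core`, and by `no-jump` near `Core ∩ A`, which forces `b` into `A`.
    Core-unsplit : ∀ {A B} → Open A → Open B → Core ⊆ A ∪ B → ε ∈ A →
                   (Core ∩ A) ⊥ B → ¬ (Core ≬ B)
    Core-unsplit {A} {B} oA oB Q⊆A∪B ε∈A disjoint (b , b∈Q , b∈B)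
      with M , thick ← thicken (Core∩-compact oB Q⊆A∪B disjoint) oA proj₂
      -- Halving twice keeps products of three elements of `N` inside `M`.
      with M₁ , M₁⊆M , halfM ← halve M
      with N , N⊆M₁ , halfM₁ ← halve M₁
      with L , L⊆ ← shrink (thickening-open N Core) (λ q∈Q → _ , q∈Q , ∈-translate _ N)
      with q , q∈Q₁ , b∈qN ← no-jump oA ε∈A
             (λ q∈Q₁ u∈N v∈N w∈N → thick q∈Q₁ (halfM (halfM₁ u∈N v∈N) (N⊆M₁ w∈N)))
             L⊆ (Core⊆Chain (L ⊓ N) b∈Q)
      = disjoint ((b∈Q , Open-resp-≈ oA (\\-leftDividesˡ q b) (thick q∈Q₁ (M₁⊆M (N⊆M₁ b∈qN)))) , b∈B)

    Core-connected : Connected Core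
    Core-connected oU oV Q⊆U∪V Q≬U Q≬V disjoint with Q⊆U∪V ε∈Core
    ... | inj₁ ε∈U = Core-unsplit oU oV Q⊆U∪V ε∈U disjoint Q≬V
    ... | inj₂ ε∈V = Core-unsplit oV oU ([ inj₂ , inj₁ ] ∘ Q⊆U∪V) ε∈V
      (λ ((x∈Q , x∈V) , x∈U) → disjoint ((x∈Q , x∈U) , x∈V)) Q≬U

    Core-trivial : ∀ {x} → x ∈ Core → ε ≈ x
    Core-trivial x∈Q = totallyDisconnected Core-resp Core-connected ε∈Core x∈Q

    -- When steps of size `N` cannot leave `K`, the chain component of `ε` is the subgroup generated
    -- by `N`.
    module _ {N} (closed : ∀ {x v} → x ∈ Chain K N → v ∈ nbhd N → (x ∙ v) ∈ K) where

      Chain-step : ∀ {x v} → x ∈ Chain K N → v ∈ nbhd N → (x ∙ v) ∈ Chain K N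
      Chain-step x∈U v∈N = step x∈U v∈N (closed x∈U v∈N) refl

      Chain-∙ : ∀ {x y} → x ∈ Chain K N → y ∈ Chain K N → (x ∙ y) ∈ Chain K N
      Chain-∙ x∈U (start y≈ε) =
        Chain-resp K-resp (sym (trans (∙-congˡ y≈ε) (identityʳ _))) x∈U
      Chain-∙ x∈U (step y∈U v∈N _ z≈yv) =
        Chain-resp K-resp (trans (assoc _ _ _) (∙-congˡ (sym z≈yv))) (Chain-step (Chain-∙ x∈U y∈U) v∈N)

      Chain-⁻¹ : ∀ {x} → x ∈ Chain K N → (x ⁻¹) ∈ Chain K N
      Chain-⁻¹ (start x≈ε) = start (trans (⁻¹-cong x≈ε) ε⁻¹≈ε)
      Chain-⁻¹ (step {x} {v = v} x∈U v∈N _ z≈xv) =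
        Chain-resp K-resp (sym (trans (⁻¹-cong z≈xv) (⁻¹-anti-homo-∙ x v)))
          (Chain-∙ (Chain-resp K-resp (identityˡ _) (Chain-step (start refl) (nbhd-⁻¹ N v∈N)))
                   (Chain-⁻¹ x∈U))

      Chain-subgroup : IsSubgroup (Chain K N)
      Chain-subgroup = record
        { resp = Chain-resp K-resp ; ε-closed = start refl
        ; ∙-closed = Chain-∙ ; ⁻¹-closed = Chain-⁻¹ }

      Chain-open : Open (Chain K N)
      Chain-open = Open-local λ {x} x∈U →
        translate x N , translate-open x N , ∈-translate x N , λ {z} z∈xN →
          Chain-resp K-resp (\\-leftDividesˡ x z) (Chain-step x∈U z∈xN)

  -- Van Dantzig's theorem.

  record CompactOpenSubgroup : Set (Level.suc (c ⊔ ℓ) ⊔ o) where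
    field
      subset     : Subset
      isSubgroup : IsSubgroup subset
      isCompact  : Compact subset
      isOpen     : Open subset
    open IsSubgroup isSubgroup public
  open CompactOpenSubgroup using (subset)

  vanDantzig : ∀ {W} → Open W → ε ∈ W → ∃[ U ] subset U ⊆ W
  vanDantzig {W} oW ε∈W
    with O , K , oO , K-resp , K-compact , ε∈O , O⊆K ← locallyCompact ε
    = fromNbhd K-compact K-resp (O⊆K ε∈O) (Open-∩ oW oO) (ε∈W , ε∈O) proj₁ (O⊆K ∘ proj₂)
    where
    fromNbhd : ∀ {K V} → Compact K → K Respects _≈_ → ε ∈ K → Open V → ε ∈ V → V ⊆ W → V ⊆ K →
               ∃[ U ] subset U ⊆ W
    fromNbhd {K} K-compact K-resp ε∈K oV ε∈V V⊆W V⊆K = result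
      where
      open Chains K-compact K-resp ε∈K

      result : ∃[ U ] subset U ⊆ W
      result
        with M , M⊆V ← shrink oV (λ x∈Q → Open-resp-≈ oV (Core-trivial x∈Q) ε∈V)
        -- The `M`-component is compact and lies in the open set `V`, so steps from it by elements
        -- of a small `L` stay in `V`, hence in `K`. Steps of size `M ⊓ L` therefore satisfy the
        -- closure condition.
        with L , stay ← thicken (Chain-compact M) oV M⊆V
        = let closed : ∀ {x v} → x ∈ Chain K (M ⊓ L) → v ∈ nbhd (M ⊓ L) → (x ∙ v) ∈ K
              closed = λ x∈U v∈N → V⊆K (stay (Chain-mono proj₁ x∈U) (proj₂ v∈N))
          in record
            { subset     = Chain K (M ⊓ L)
            ; isSubgroup = Chain-subgroup {M ⊓ L} closed
            ; isCompact  = Chain-compact (M ⊓ L)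
            ; isOpen     = Chain-open {M ⊓ L} closed
            } , λ x∈U → V⊆W (M⊆V (Chain-mono proj₁ x∈U))

-- Compact open cosets and their groupoid operations.

module Cosets (em : ∀ {a} → ExcludedMiddle a) {c ℓ o} (G : TDLCGroup c ℓ o) where
  open Classical em
  open TDLCGroup G
  open MeetGroupoid G
  open TopologicalGroup em G
  open CompactOpenSubgroup
  open GroupProperties group using
    (\\-leftDividesˡ; \\-leftDividesʳ; //-rightDividesˡ; //-rightDividesʳ; ⁻¹-involutive; ⁻¹-anti-homo-∙)
  open SetoidReasoning setoid hiding (start)

  -- The preimage under `φ` is the image under its inverse `ψ`, so a cover of it pulls back along
  -- `ψ` to a cover of `U`.
  Compact-preimage : ∀ {U : Subset} (φ ψ : Carrier → Carrier) → U Respects _≈_ →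
                     (∀ x → φ (ψ x) ≈ x) → (∀ x → ψ (φ x) ≈ x) →
                     (∀ {V} → Open V → Open (λ x → ψ x ∈ V)) →
                     Compact U → Compact (λ x → φ x ∈ U)
  Compact-preimage φ ψ resp φψ ψφ ψ-continuous compact I V oV cover =
    let is , U⊆ = compact I (λ i x → ψ x ∈ V i) (λ i → ψ-continuous (oV i))
                    (λ {x} x∈U → cover (resp (sym (φψ x)) x∈U))
    in is , λ {x} φx∈U → Any.map (λ {i} → Open-resp-≈ (oV i) (ψφ x)) (U⊆ φx∈U)

  coset : Carrier → Subset → Subset
  coset x U z = (x ⁻¹ ∙ z) ∈ U

  -- The conjugate gUg⁻¹, written as a preimage so that openness follows from continuity of
  -- translations.
  conj : Carrier → Subset → Subset
  conj g U z = ((g ⁻¹ ∙ z) ∙ g) ∈ U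

  conjugate : Carrier → CompactOpenSubgroup → CompactOpenSubgroup
  conjugate g U = record
    { subset     = conj g (subset U)
    ; isSubgroup = record
      { resp      = λ x≈y → resp U (∙-congʳ (∙-congˡ x≈y))
      ; ε-closed  = resp U (sym (trans (∙-congʳ (identityʳ _)) (inverseˡ g))) (ε-closed U)
      ; ∙-closed  = λ {x} {y} x∈ y∈ → resp U (begin
          ((g ⁻¹ ∙ x) ∙ g) ∙ ((g ⁻¹ ∙ y) ∙ g) ≈⟨ assoc _ _ _ ⟩
          (g ⁻¹ ∙ x) ∙ (g ∙ ((g ⁻¹ ∙ y) ∙ g)) ≈⟨ ∙-congˡ (∙-congˡ (assoc _ _ _)) ⟩
          (g ⁻¹ ∙ x) ∙ (g ∙ (g ⁻¹ ∙ (y ∙ g))) ≈⟨ ∙-congˡ (\\-leftDividesˡ g _) ⟩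
          (g ⁻¹ ∙ x) ∙ (y ∙ g)                ≈⟨ assoc _ _ _ ⟨
          ((g ⁻¹ ∙ x) ∙ y) ∙ g                ≈⟨ ∙-congʳ (assoc _ _ _) ⟩
          (g ⁻¹ ∙ (x ∙ y)) ∙ g                ∎)
          (∙-closed U x∈ y∈)
      ; ⁻¹-closed = λ {x} x∈ → resp U (begin
          ((g ⁻¹ ∙ x) ∙ g) ⁻¹    ≈⟨ ⁻¹-anti-homo-∙ _ _ ⟩
          g ⁻¹ ∙ (g ⁻¹ ∙ x) ⁻¹   ≈⟨ ∙-congˡ (⁻¹-anti-homo-∙ _ _) ⟩
          g ⁻¹ ∙ (x ⁻¹ ∙ g ⁻¹ ⁻¹) ≈⟨ ∙-congˡ (∙-congˡ (⁻¹-involutive g)) ⟩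
          g ⁻¹ ∙ (x ⁻¹ ∙ g)      ≈⟨ assoc _ _ _ ⟨
          (g ⁻¹ ∙ x ⁻¹) ∙ g      ∎)
          (⁻¹-closed U x∈)
      }
    ; isCompact  = Compact-preimage (λ x → (g ⁻¹ ∙ x) ∙ g) (λ x → (g ∙ x) ∙ g ⁻¹) (resp U)
        (λ x → trans (∙-congʳ (trans (∙-congˡ (assoc _ _ _)) (\\-leftDividesʳ g _))) (//-rightDividesˡ g x))
        (λ x → trans (∙-congʳ (trans (∙-congˡ (assoc _ _ _)) (\\-leftDividesˡ g _))) (//-rightDividesʳ g x))
        (λ oV → Open-∙ˡ g (Open-∙ʳ (g ⁻¹) oV)) (isCompact U)
    ; isOpen     = Open-∙ˡ (g ⁻¹) (Open-∙ʳ g (isOpen U))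
    }

  coset-left : ∀ x U → coset x (subset U) LeftCosetOf subset U
  coset-left x U = x ,
    (λ {z} z∈ → x ⁻¹ ∙ z , z∈ , sym (\\-leftDividesˡ x z)) ,
    (λ (u , u∈U , z≈xu) → resp U (sym (trans (∙-congˡ z≈xu) (\\-leftDividesʳ x u))) u∈U)

  coset-right : ∀ x U → coset x (subset U) RightCosetOf conj x (subset U)
  coset-right x U = x ,
    (λ {z} z∈ → z ∙ x ⁻¹ ,
      resp U (sym (trans (assoc _ _ _) (∙-congˡ (//-rightDividesˡ x z)))) z∈ ,
      sym (//-rightDividesˡ x z)) ,
    (λ (u , u∈ , z≈ux) → resp U (trans (assoc _ _ _) (∙-congˡ (sym z≈ux))) u∈)

  coset-𝓦 : Carrier → CompactOpenSubgroup → 𝓦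
  coset-𝓦 x U = record
    { set  = coset x (subset U)
    ; elem = inj₂ (subset U , isSubgroup U , isCompact U , isOpen U , inj₁ (coset-left x U)) }

  ∈-coset : ∀ x U → x ∈ coset x (subset U)
  ∈-coset x U = resp U (sym (inverseˡ x)) (ε-closed U)

  -- With V = yUy⁻¹, the set xV is a left coset of V, while yU = Vy is a right coset of V.
  coset-product : ∀ x y U →
    Product (coset-𝓦 x (conjugate y U)) (coset-𝓦 y U) (coset-𝓦 (x ∙ y) U)
  coset-product x y U = inj₂
    ( (x , ∈-coset x (conjugate y U)) , (y , ∈-coset y U)
    , (conj y (subset U) , isSubgroup (conjugate y U) , coset-left x (conjugate y U) , coset-right y U)
    , (λ {z} z∈ → x , x ⁻¹ ∙ z , ∈-coset x (conjugate y U) ,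
         resp U (trans (∙-congʳ (⁻¹-anti-homo-∙ x y)) (assoc _ _ _)) z∈ ,
         sym (\\-leftDividesˡ x z))
    , (λ {z} (b , d , b∈ , d∈ , z≈bd) → resp U (begin
         ((y ⁻¹ ∙ (x ⁻¹ ∙ b)) ∙ y) ∙ (y ⁻¹ ∙ d) ≈⟨ assoc _ _ _ ⟩
         (y ⁻¹ ∙ (x ⁻¹ ∙ b)) ∙ (y ∙ (y ⁻¹ ∙ d)) ≈⟨ ∙-congˡ (\\-leftDividesˡ y d) ⟩
         (y ⁻¹ ∙ (x ⁻¹ ∙ b)) ∙ d                ≈⟨ ∙-congʳ (assoc _ _ _) ⟨
         ((y ⁻¹ ∙ x ⁻¹) ∙ b) ∙ d                ≈⟨ assoc _ _ _ ⟩
         (y ⁻¹ ∙ x ⁻¹) ∙ (b ∙ d)                ≈⟨ ∙-cong (⁻¹-anti-homo-∙ x y) z≈bd ⟨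
         (x ∙ y) ⁻¹ ∙ z                         ∎)
         (∙-closed U b∈ d∈)) )

  -- (xU)⁻¹ = Ux⁻¹ = x⁻¹(xUx⁻¹).
  coset-inverse : ∀ x U → Inverse (coset-𝓦 x U) (coset-𝓦 (x ⁻¹) (conjugate x U))
  coset-inverse x U =
    (λ {z} z∈ → z ⁻¹ ,
      resp U (trans (⁻¹-cong (simplify z)) (⁻¹-anti-homo-∙ z x)) (⁻¹-closed U z∈) ,
      sym (⁻¹-involutive z)) ,
    (λ {z} (y , y∈ , z≈y⁻¹) → resp U (begin
      (x ⁻¹ ∙ y) ⁻¹                 ≈⟨ ⁻¹-anti-homo-∙ _ _ ⟩
      y ⁻¹ ∙ x ⁻¹ ⁻¹                ≈⟨ ∙-cong (sym z≈y⁻¹) (⁻¹-involutive x) ⟩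
      z ∙ x                         ≈⟨ simplify z ⟨
      (x ⁻¹ ∙ (x ⁻¹ ⁻¹ ∙ z)) ∙ x    ∎)
      (⁻¹-closed U y∈))
    where
    simplify : ∀ z → (x ⁻¹ ∙ (x ⁻¹ ⁻¹ ∙ z)) ∙ x ≈ z ∙ x
    simplify z = ∙-congʳ (\\-leftDividesˡ (x ⁻¹) z)

  Inverse-sym : ∀ A B → set A Respects _≈_ → Inverse A B → Inverse B A
  Inverse-sym A B resp (B⊆ , ⊆B) =
    (λ {z} z∈A → z ⁻¹ , ⊆B (z , z∈A , refl) , sym (⁻¹-involutive z)) ,
    (λ (y , y∈B , z≈y⁻¹) → let a , a∈A , y≈a⁻¹ = B⊆ y∈B in
      resp (sym (trans z≈y⁻¹ (trans (⁻¹-cong y≈a⁻¹) (⁻¹-involutive a)))) a∈A)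

  left⇒coset : ∀ {A x} U → A LeftCosetOf subset U → x ∈ A → A ≐ coset x (subset U)
  left⇒coset {A} {x} U (g , A⊆ , ⊆A) x∈A with u , u∈U , x≈gu ← A⊆ x∈A =
    (λ {z} z∈A → let v , v∈U , z≈gv = A⊆ z∈A in resp U (begin
      u ⁻¹ ∙ v                 ≈⟨ ∙-congˡ (\\-leftDividesʳ g v) ⟨
      u ⁻¹ ∙ (g ⁻¹ ∙ (g ∙ v))  ≈⟨ assoc _ _ _ ⟨
      (u ⁻¹ ∙ g ⁻¹) ∙ (g ∙ v)  ≈⟨ ∙-cong (⁻¹-anti-homo-∙ g u) z≈gv ⟨
      (g ∙ u) ⁻¹ ∙ z           ≈⟨ ∙-congʳ (⁻¹-cong x≈gu) ⟨
      x ⁻¹ ∙ z                 ∎)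
      (∙-closed U (⁻¹-closed U u∈U) v∈U)) ,
    (λ {z} z∈ → ⊆A (u ∙ (x ⁻¹ ∙ z) , ∙-closed U u∈U z∈ , (begin
      z                        ≈⟨ \\-leftDividesˡ x z ⟨
      x ∙ (x ⁻¹ ∙ z)           ≈⟨ ∙-congʳ x≈gu ⟩
      (g ∙ u) ∙ (x ⁻¹ ∙ z)     ≈⟨ assoc _ _ _ ⟩
      g ∙ (u ∙ (x ⁻¹ ∙ z))     ∎)))

  right⇒left : ∀ {A} U (A-right : A RightCosetOf subset U) →
               A LeftCosetOf conj (proj₁ A-right ⁻¹) (subset U)
  right⇒left U (g , A⊆ , ⊆A) = g ,
    (λ {z} z∈A → let u , u∈U , z≈ug = A⊆ z∈A in
      g ⁻¹ ∙ z ,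
      resp U (sym (trans (∙-congʳ (trans (\\-leftDividesʳ (g ⁻¹) z) z≈ug)) (//-rightDividesʳ g u))) u∈U ,
      sym (\\-leftDividesˡ g z)) ,
    (λ {z} (v , v∈ , z≈gv) → ⊆A (_ , v∈ , (begin
      z                             ≈⟨ z≈gv ⟩
      g ∙ v                         ≈⟨ ∙-congʳ (⁻¹-involutive g) ⟨
      g ⁻¹ ⁻¹ ∙ v                   ≈⟨ //-rightDividesˡ g _ ⟨
      ((g ⁻¹ ⁻¹ ∙ v) ∙ g ⁻¹) ∙ g    ∎)))

  -- Ug = g(g⁻¹Ug) turns right cosets into left ones, and any point of a coset represents it; later
  -- arguments can thus choose the representative.
  toCoset : ∀ A {x} → x ∈ set A → ∃[ U ] set A ≐ coset x (subset U)
  toCoset A x∈A with elem A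
  ... | inj₁ (A⊆∅ , _) = ⊥-elim (A⊆∅ x∈A)
  ... | inj₂ (U , U-sub , U-compact , U-open , inj₁ left) = U′ , left⇒coset U′ left x∈A
    where
    U′ = record { subset = U ; isSubgroup = U-sub ; isCompact = U-compact ; isOpen = U-open }
  ... | inj₂ (U , U-sub , U-compact , U-open , inj₂ right@(g , _)) =
    conjugate (g ⁻¹) U′ , left⇒coset (conjugate (g ⁻¹) U′) (right⇒left U′ right) x∈A
    where
    U′ = record { subset = U ; isSubgroup = U-sub ; isCompact = U-compact ; isOpen = U-open }

  Compact-resp-≐ : ∀ {K L : Subset} → K ≐ L → Compact K → Compact L
  Compact-resp-≐ (K⊆L , L⊆K) compact I U oU L⊆⋃ =
    let is , K⊆ = compact I U oU (L⊆⋃ ∘ K⊆L) in is , K⊆ ∘ L⊆K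

  coset-compact : ∀ x U → Compact (coset x (subset U))
  coset-compact x U = Compact-preimage (x ⁻¹ ∙_) (x ∙_) (resp U)
    (\\-leftDividesʳ x) (\\-leftDividesˡ x) (Open-∙ˡ x) (isCompact U)

  coset-open : ∀ x U → Open (coset x (subset U))
  coset-open x U = Open-∙ˡ (x ⁻¹) (isOpen U)

  𝓦-compact : ∀ A → Compact (set A)
  𝓦-compact A with em {P = Satisfiable (set A)}
  ... | no empty = λ I U oU cover → [] , λ x∈A → ⊥-elim (empty (_ , x∈A))
  ... | yes (x , x∈A) with U , A⊆ , ⊆A ← toCoset A x∈A =
    Compact-resp-≐ (⊆A , A⊆) (coset-compact x U)

  𝓦-open : ∀ A → Open (set A)
  𝓦-open A = Open-local λ {x} x∈A → let U , A⊆ , ⊆A = toCoset A x∈A in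
    coset x (subset U) , coset-open x U , ∈-coset x U , ⊆A

  𝓦-resp : ∀ A → set A Respects _≈_
  𝓦-resp A = Open-resp-≈ (𝓦-open A)

  basis : ∀ {V x} → Open V → x ∈ V → ∃[ A ] x ∈ set A × set A ⊆ V
  basis {V} {x} oV x∈V =
    let U , U⊆ = vanDantzig {W = λ z → (x ∙ z) ∈ V} (Open-∙ˡ x oV) (Open-resp-≈ oV (sym (identityʳ x)) x∈V)
    in coset-𝓦 x U , ∈-coset x U , λ {z} z∈ → Open-resp-≈ oV (\\-leftDividesˡ x z) (U⊆ z∈)

-- Transfer of compactness and separation along continuous maps.

module _ {X : Setoid a ℓ} {Y : Setoid b ℓ′} {T : Topology X p o} {T′ : Topology Y p o′} {f : Func X Y} where
  private
    module X = Setoid X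
    module Y = Setoid Y
    module T = Topology T
    module T′ = Topology T′

  Compact-image : Continuous T T′ f → (∀ y → ∃[ x ] Func.to f x Y.≈ y) →
                  T.Compact {q = p} (λ _ → ⊤) → T′.Compact {q = p} (λ _ → ⊤)
  Compact-image continuous surjective compact I V oV cover =
    let is , ⊆ = compact I (λ i x → Func.to f x ∈ V i) (λ i → continuous (V i) (oV i))
                   (λ _ → cover {Func.to f _} _)
    in is , λ {y} _ → let x , fx≈y = surjective y in
         Any.map (λ {i} → T′.Open-resp-≈ (oV i) fx≈y) (⊆ {x} _)

  Hausdorff-preimage : Continuous T T′ f → (∀ {x y} → Func.to f x Y.≈ Func.to f y → x X.≈ y) →
                       T′.Hausdorff → T.Hausdorff
  Hausdorff-preimage continuous injective hausdorff x y x≉y =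
    let U , V , oU , oV , fx∈U , fy∈V , U⊥V = hausdorff (Func.to f x) (Func.to f y) (x≉y ∘ injective)
    in _ , _ , continuous U oU , continuous V oV , fx∈U , fy∈V , U⊥V

-- The correspondence between ideals and closed subgroups.

module ClosedSubgroupIdeals
  (em : ∀ {a} → ExcludedMiddle a) (ext : ∀ {a b} → Extensionality a b)
  {c ℓ o} (G : TDLCGroup c ℓ o)
  where
  open Classical em
  open TDLCGroup G
  open MeetGroupoid G
  open TopologicalGroup em G
  open CompactOpenSubgroup using (subset; resp)
  open Cosets em G
  open GroupProperties group using
    (⁻¹-involutive)
  open IsClosedSubgroupIdeal
  open IsIdeal

  Ideal : Set w
  Ideal = Setoid.Carrier CSI

  infix 4 _∈ⁱ_
  _∈ⁱ_ : 𝓦 → Ideal → Set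
  A ∈ⁱ J = A ∈ᴶ proj₁ J

  Covered : Ideal → Pred Carrier w
  Covered J x = ∃[ A ] A ∈ⁱ J × x ∈ set A

  ∈ⁱ-⊆ : ∀ J {A B} → set A ⊆ set B → B ∈ⁱ J → A ∈ⁱ J
  ∈ⁱ-⊆ (_ , J) A⊆B B∈J = ∪-closed (isIdeal J) (_ ∷ []) (B∈J ∷ []) _ (here ∘ A⊆B)

  Compact-covered : ∀ {K : Subset} J → Compact K → K ⊆ Covered J →
                    ∃[ Bs ] All (_∈ⁱ J) Bs × K ⊆ (λ x → Any (λ B → x ∈ set B) Bs)
  Compact-covered J compact K⊆ =
    let Bs , K⊆Bs = finiteSubcover {I = ∃[ A ] A ∈ⁱ J} compact (set ∘ proj₁) (𝓦-open ∘ proj₁)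
                      (λ x∈K → let A , A∈J , x∈A = K⊆ x∈K in (A , A∈J) , x∈A)
    in List.map proj₁ Bs , All.map⁺ (All.universal proj₂ Bs) , Any.map⁺ ∘ K⊆Bs

  -- Primality for the factorisation of xyU into x(yUy⁻¹) and yU.
  coset-prime : ∀ J x y U → coset-𝓦 (x ∙ y) U ∈ⁱ J →
                coset-𝓦 x (conjugate y U) ∈ⁱ J ⊎ coset-𝓦 y U ∈ⁱ J
  coset-prime (_ , csi) x y U =
    prime csi (coset-𝓦 x (conjugate y U)) (coset-𝓦 y U) (coset-𝓦 (x ∙ y) U)
      (x , ∈-coset x (conjugate y U)) (y , ∈-coset y U) (coset-product x y U)

  -- If U ∈ J for a compact open subgroup U, then gU ∈ J for every g, as
  -- (gU)⁻¹ · gU = U; finitely many of these cosets cover any compact set.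
  ε∉member : ∀ J {A} → A ∈ⁱ J → ε ∉ set A
  ε∉member J@(_ , csi) {A} A∈J ε∈A with U , A⊆ , ⊆A ← toCoset A ε∈A =
    proper csi λ B →
      let gs , B⊆ = finiteSubcover (𝓦-compact B) (λ g → coset g (subset U)) (λ g → coset-open g U)
                      (λ {g} _ → g , ∈-coset g U)
      in ∪-closed (isIdeal csi) (List.map (λ g → coset-𝓦 g U) gs)
           (All.map⁺ (All.universal (λ g → translate-member g) gs)) B (Any.map⁺ ∘ B⊆)
    where
    translate-member : ∀ g → coset-𝓦 g U ∈ⁱ J
    translate-member g
      with coset-prime J (g ⁻¹) g U
             (∈ⁱ-⊆ J {coset-𝓦 (g ⁻¹ ∙ g) U} {A}
               (⊆A ∘ resp U (∙-congʳ (⁻¹-cong (inverseˡ g)))) A∈J)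
    ... | inj₂ gU∈J = gU∈J
    ... | inj₁ Ug⁻¹∈J = ⁻¹-closed csi Ug⁻¹ gU
      (Inverse-sym gU Ug⁻¹ (𝓦-resp gU) (coset-inverse g U)) Ug⁻¹∈J
      where
      gU   = coset-𝓦 g U
      Ug⁻¹ = coset-𝓦 (g ⁻¹) (conjugate g U)

  Covered-⁻¹ : ∀ J {x} → Covered J (x ⁻¹) → Covered J x
  Covered-⁻¹ J@(_ , csi) {x} (A , A∈J , x⁻¹∈A) with U , A⊆ , ⊆A ← toCoset A x⁻¹∈A =
    A⁻¹ , ⁻¹-closed csi (coset-𝓦 (x ⁻¹) U) A⁻¹ (coset-inverse (x ⁻¹) U)
          (∈ⁱ-⊆ J {coset-𝓦 (x ⁻¹) U} {A} ⊆A A∈J) ,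
    𝓦-resp A⁻¹ (⁻¹-involutive x) (∈-coset (x ⁻¹ ⁻¹) (conjugate (x ⁻¹) U))
    where
    A⁻¹ = coset-𝓦 (x ⁻¹ ⁻¹) (conjugate (x ⁻¹) U)

  -- A member of `J` containing xy contains some coset xyU, to which primality applies. The
  -- contrapositive is closure of the complement under products.
  Covered-∙ : ∀ J {x y} → Covered J (x ∙ y) → Covered J x ⊎ Covered J y
  Covered-∙ J@(_ , csi) {x} {y} (A , A∈J , xy∈A) with U , A⊆ , ⊆A ← toCoset A xy∈A
    with coset-prime J x y U (∈ⁱ-⊆ J {coset-𝓦 (x ∙ y) U} {A} ⊆A A∈J)
  ... | inj₁ B∈J = inj₁ (_ , B∈J , ∈-coset x (conjugate y U))
  ... | inj₂ B∈J = inj₂ (_ , B∈J , ∈-coset y U)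

  -- `S⟨ J ⟩` quantifies over `𝓦` and lies above the level of `Subset`; `Small` resizes it.
  Uncovered : Ideal → Subset
  Uncovered J x = Small (c ⊔ ℓ) (x ∈ S⟨ J ⟩)

  uncovered⁺ : ∀ J {x} → ¬ Covered J x → Uncovered J x
  uncovered⁺ _ = small

  uncovered⁻ : ∀ J {x} → Uncovered J x → ¬ Covered J x
  uncovered⁻ _ = unsmall

  toSubgroup : Ideal → ClosedSubgroup
  toSubgroup J = record
    { carrier    = Uncovered J
    ; isSubgroup = record
      { resp      = λ x≈y x∈S → uncovered⁺ J λ (A , A∈J , y∈A) →
          uncovered⁻ J x∈S (A , A∈J , 𝓦-resp A (sym x≈y) y∈A)
      ; ε-closed  = uncovered⁺ J λ (A , A∈J , ε∈A) → ε∉member J {A} A∈J ε∈A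
      ; ∙-closed  = λ x∈S y∈S → uncovered⁺ J ([ uncovered⁻ J x∈S , uncovered⁻ J y∈S ] ∘ Covered-∙ J)
      ; ⁻¹-closed = λ x∈S → uncovered⁺ J (uncovered⁻ J x∈S ∘ Covered-⁻¹ J)
      }
    ; closed     = Open-local λ x∉S → let A , A∈J , x∈A = stable (x∉S ∘ uncovered⁺ J) in
        set A , 𝓦-open A , x∈A , λ y∈A y∈S → uncovered⁻ J y∈S (A , A∈J , y∈A)
    }

  Γ : Func CSI 𝓢
  Γ = record
    { to   = toSubgroup
    ; cong = λ {J} {J′} J≈J′ →
        (λ x∈S → uncovered⁺ J′ λ (A , A∈J′ , x∈A) →
          uncovered⁻ J x∈S (A , ≡.trans (J≈J′ A) A∈J′ , x∈A)) ,
        (λ x∈S → uncovered⁺ J λ (A , A∈J , x∈A) →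
          uncovered⁻ J′ x∈S (A , ≡.trans (≡.sym (J≈J′ A)) A∈J , x∈A))
    }

  ideal : ClosedSubgroup → Setoid.Carrier 𝒫𝓦
  ideal S = record
    { to   = λ A → ⌊ set A ⊥ carrier S ⌋
    ; cong = λ (A⊆B , B⊆A) → ⌊⌋-cong (λ A⊥S (x∈B , x∈S) → A⊥S (B⊆A x∈B , x∈S))
                                     (λ B⊥S (x∈A , x∈S) → B⊥S (A⊆B x∈A , x∈S))
    }

  ideal⁺ : ∀ S A → set A ⊥ carrier S → A ∈ᴶ ideal S
  ideal⁺ _ _ = ⌊⌋⁺

  ideal⁻ : ∀ S A → A ∈ᴶ ideal S → set A ⊥ carrier S
  ideal⁻ _ _ = ⌊⌋⁻

  -- If `A` and `B` both met `S`, the product of the two common points would lie in `C` and in `S`.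
  ideal-prime : ∀ S A B C → set A · set B ⊆ set C → C ∈ᴶ ideal S → A ∈ᴶ ideal S ⊎ B ∈ᴶ ideal S
  ideal-prime S A B C ⊆C C∈ =
    [ (λ (A⊥S : set A ⊥ carrier S) → inj₁ (ideal⁺ S A A⊥S)) , (λ A∩S → inj₂ (ideal⁺ S B (disjoint A∩S))) ]′
      (toSum em)
    where
    disjoint : ¬ (set A ⊥ carrier S) → set B ⊥ carrier S
    disjoint A∩S (y∈B , y∈S) = A∩S λ (x∈A , x∈S) →
      ideal⁻ S C C∈ (⊆C (_ , _ , x∈A , y∈B , refl) , IsSubgroup.∙-closed (isSubgroup S) x∈S y∈S)

  ideal-isClosedSubgroupIdeal : ∀ S → IsClosedSubgroupIdeal (ideal S)
  ideal-isClosedSubgroupIdeal S = record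
    { isIdeal   = record
      { ∅-mem    = λ A (A⊆∅ , _) → ideal⁺ S A λ (x∈A , _) → A⊆∅ x∈A
      ; ∪-closed = λ Bs Bs∈ A A⊆ → ideal⁺ S A λ (x∈A , x∈S) →
          All.lookupWith (λ {B} B∈ x∈B → ideal⁻ S B B∈ (x∈B , x∈S)) Bs∈ (A⊆ x∈A)
      }
    ; proper    = λ all → let A , ε∈A , _ = basis Open-⊤ _ in
        ideal⁻ S A (all A) (ε∈A , S.ε-closed)
    ; ⁻¹-closed = λ A B (B⊆ , _) A∈ → ideal⁺ S B λ (y∈B , y∈S) →
        let x , x∈A , y≈x⁻¹ = B⊆ y∈B in
        ideal⁻ S A A∈ (x∈A , S.resp (trans (⁻¹-cong y≈x⁻¹) (⁻¹-involutive x)) (S.⁻¹-closed y∈S))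
    ; prime     = λ
      { A B C _ _ (inj₁ ((A⊆∅ , _) , _)) _     → inj₁ (ideal⁺ S A λ (x∈A , _) → A⊆∅ x∈A)
      ; A B C _ _ (inj₂ (_ , _ , _ , _ , ⊆C)) → ideal-prime S A B C ⊆C }
    }
    where
    module S = IsSubgroup (isSubgroup S)

  toIdeal : ClosedSubgroup → Ideal
  toIdeal S = ideal S , ideal-isClosedSubgroupIdeal S

  Γ⁻¹ : Func 𝓢 CSI
  Γ⁻¹ = record
    { to   = toIdeal
    ; cong = λ (S⊆T , T⊆S) A → ⌊⌋-cong (λ A⊥S (x∈A , x∈T) → A⊥S (x∈A , T⊆S x∈T))
                                       (λ A⊥T (x∈A , x∈S) → A⊥T (x∈A , S⊆T x∈S))
    }

  -- For the converse, `A` lies in the union of `J`; by compactness finitely many members cover it,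
  -- and the ideal axiom gives `A ∈ⁱ J`.
  ∈ⁱ⇔disjoint : ∀ J A → (A ∈ⁱ J → set A ⊥ carrier (toSubgroup J)) ×
                        (set A ⊥ carrier (toSubgroup J) → A ∈ⁱ J)
  ∈ⁱ⇔disjoint J@(_ , csi) A =
    (λ A∈J (x∈A , x∈S) → uncovered⁻ J x∈S (A , A∈J , x∈A)) ,
    (λ A⊥S → let Bs , Bs∈J , A⊆ = Compact-covered J (𝓦-compact A)
                                     (λ x∈A → stable λ x∉ → A⊥S (x∈A , uncovered⁺ J x∉))
             in ∪-closed (isIdeal csi) Bs Bs∈J A A⊆)

  toIdeal-toSubgroup : ∀ J → Setoid._≈_ CSI (toIdeal (toSubgroup J)) J
  toIdeal-toSubgroup J A = ⇔→≡ (mk⇔ (λ A∈ → proj₂ (∈ⁱ⇔disjoint J A) (ideal⁻ S A A∈))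
                                    (λ A∈J → ideal⁺ S A (proj₁ (∈ⁱ⇔disjoint J A) A∈J)))
    where
    S = toSubgroup J

  -- A point outside the closed set `S` lies in a basic coset disjoint from `S`, and that coset
  -- belongs to the ideal of `S`.
  toSubgroup-toIdeal : ∀ S → Setoid._≈_ 𝓢 (toSubgroup (toIdeal S)) S
  toSubgroup-toIdeal S =
    (λ {x} x∈ → stable λ x∉S → let A , x∈A , A⊆ = basis (closed S) x∉S in
      uncovered⁻ (toIdeal S) x∈ (A , ideal⁺ S A (λ (y∈A , y∈S) → A⊆ y∈A y∈S) , x∈A)) ,
    (λ x∈S → uncovered⁺ (toIdeal S) λ (A , A∈ , x∈A) → ideal⁻ S A A∈ (x∈A , x∈S))

  Γ-inverse : Inverseᵇ (Setoid._≈_ CSI) (Setoid._≈_ 𝓢) toSubgroup toIdeal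
  Γ-inverse =
    (λ {S} {J} J≈ → Setoid.trans 𝓢 {toSubgroup J} {toSubgroup (toIdeal S)} {S}
      (Func.cong Γ {J} {toIdeal S} J≈) (toSubgroup-toIdeal S)) ,
    (λ {J} {S} S≈ → Setoid.trans CSI {toIdeal S} {toIdeal (toSubgroup J)} {J}
      (Func.cong Γ⁻¹ {S} {toSubgroup J} S≈) (toIdeal-toSubgroup J))

  Γ-injective : ∀ {J J′} → Setoid._≈_ 𝓢 (toSubgroup J) (toSubgroup J′) → Setoid._≈_ CSI J J′
  Γ-injective {J} {J′} eq A = ≡.trans (≡.sym (toIdeal-toSubgroup J A))
    (proj₂ Γ-inverse {J′} {toSubgroup J} eq A)

  Γ⁻¹-injective : ∀ {S T} → Setoid._≈_ CSI (toIdeal S) (toIdeal T) → Setoid._≈_ 𝓢 S T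
  Γ⁻¹-injective {S} {T} eq = Setoid.trans 𝓢 {S} {toSubgroup (toIdeal S)} {T}
    (Setoid.sym 𝓢 {toSubgroup (toIdeal S)} {S} (toSubgroup-toIdeal S))
    (proj₁ Γ-inverse {T} {toIdeal S} eq)

  Γ-bijective : Bijective (Setoid._≈_ CSI) (Setoid._≈_ 𝓢) toSubgroup
  Γ-bijective = (λ {J} {J′} → Γ-injective {J} {J′}) ,
    λ S → toIdeal S , λ {J} → proj₁ Γ-inverse {S} {J}

-- Continuity of `Γ` and of its inverse.

module ChabautySpace
  (em : ∀ {a} → ExcludedMiddle a) (ext : ∀ {a b} → Extensionality a b)
  {c ℓ o} (G : TDLCGroup c ℓ o)
  where
  open Classical em
  open TDLCGroup G using (ε; Open; Compact; Open-⊤)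
  open MeetGroupoid G
  open Cosets em G
  open ClosedSubgroupIdeals em ext G
  open IsClosedSubgroupIdeal
  open IsIdeal

  private
    module CSI-top = Topology CSI-topology
    module Chabauty-top = Topology Chabauty

  Literals : Set w
  Literals = List (𝓦 × Bool)

  -- The open subset of the power set with trace `V` is the union of all cylinders whose trace lies
  -- in `V`.
  CSI-open : ∀ {V} → (∀ J → J ∈ V → ∃[ abs ] proj₁ J ∈ Cylinder abs ×
                                     (∀ J′ → proj₁ J′ ∈ Cylinder abs → J′ ∈ V)) →
             CSI-top.Open V
  CSI-open {V} local =
    (λ F → ∃[ abs ] F ∈ Cylinder abs × (∀ J → proj₁ J ∈ Cylinder abs → J ∈ V)) ,
    (λ F (abs , F∈ , ⊆V) → abs , F∈ , λ F′∈ → abs , F′∈ , ⊆V) ,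
    (λ {J} → local J) ,
    (λ {J} (abs , J∈ , ⊆V) → ⊆V J J∈)

  Cylinder-open : ∀ abs → CSI-top.Open (λ J → proj₁ J ∈ Cylinder abs)
  Cylinder-open abs = CSI-open λ J J∈ → abs , J∈ , λ _ → id

  -- Finitely many members of `J` cover `K`; every ideal containing these members has its subgroup
  -- disjoint from `K`.
  avoids-compact : ∀ {K : Subset} J → Compact K → Uncovered J ⊥ K →
             ∃[ abs ] proj₁ J ∈ Cylinder abs × (∀ J′ → proj₁ J′ ∈ Cylinder abs → Uncovered J′ ⊥ K)
  avoids-compact J compact S⊥K =
    let Bs , Bs∈J , K⊆ = Compact-covered J compact (λ x∈K → stable λ x∉ → S⊥K (uncovered⁺ J x∉ , x∈K))
    in List.map (_, true) Bs , All.map⁺ Bs∈J , λ J′ J′∈ (x∈S , x∈K) →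
         uncovered⁻ J′ x∈S (All.lookupWith (λ {B} B∈J′ x∈B → B , B∈J′ , x∈B) (All.map⁻ J′∈) (K⊆ x∈K))

  -- A basic coset `A` inside `R` around a point of the subgroup is not in `J`; for any ideal
  -- omitting `A`, the subgroup meets `A` and hence `R`.
  meets-open : ∀ J {R} → Open R → Uncovered J ≬ R →
            ∃[ A ] Func.to (proj₁ J) A ≡ false ×
                   (∀ J′ → Func.to (proj₁ J′) A ≡ false → Uncovered J′ ≬ R)
  meets-open J oR (x , x∈S , x∈R) =
    let A , x∈A , A⊆R = basis oR x∈R
    in A , ¬-not (λ A∈J → uncovered⁻ J x∈S (A , A∈J , x∈A)) , λ J′ A∉J′ → stable λ none →
         not-¬ A∉J′ (proj₂ (∈ⁱ⇔disjoint J′ A) λ (y∈A , y∈S) → none (_ , y∈S , A⊆R y∈A))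

  meets-opens : ∀ J {Rs} → All Open Rs → All (Uncovered J ≬_) Rs →
             ∃[ abs ] proj₁ J ∈ Cylinder abs ×
                      (∀ J′ → proj₁ J′ ∈ Cylinder abs → All (Uncovered J′ ≬_) Rs)
  meets-opens J [] [] = [] , [] , λ _ _ → []
  meets-opens J (oR ∷ oRs) (S≬R ∷ S≬Rs) =
    let A , A∉J , h = meets-open J oR S≬R
        abs , J∈ , h′ = meets-opens J oRs S≬Rs
    in (A , false) ∷ abs , A∉J ∷ J∈ , λ { J′ (A∉J′ ∷ J′∈) → h J′ A∉J′ ∷ h′ J′ J′∈ }

  Γ-continuous : Continuous CSI-topology Chabauty Γ
  Γ-continuous V oV = CSI-open λ J J∈V →
    let β , (S⊥K , S≬Rs) , Ωβ⊆V = oV (toSubgroup J) J∈V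
        abs , J∈ , h = avoids-compact J (ΩIndex.K-compact β) S⊥K
        abs′ , J∈′ , h′ = meets-opens J (ΩIndex.Rs-open β) S≬Rs
    in abs ++ abs′ , All.++⁺ J∈ J∈′ , λ J′ J′∈ →
         Ωβ⊆V (h J′ (All.++⁻ˡ abs J′∈) , h′ J′ (All.++⁻ʳ abs J′∈))

  -- Since `A` is compact and open, the value `true` corresponds to Ω(A;) and `false` to Ω(∅;A).
  coordinate-open : ∀ A b → Chabauty-top.Open (λ S → ideal S ∈ Cylinder ((A , b) ∷ []))
  coordinate-open A true S (A∈ ∷ []) = record
    { K = set A ; K-resp = 𝓦-resp A ; K-compact = 𝓦-compact A ; Rs = [] ; Rs-open = [] } ,
    ((λ (x∈S , x∈A) → ideal⁻ S A A∈ (x∈A , x∈S)) , []) ,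
    λ {T} (T⊥A , _) → ideal⁺ T A (λ (x∈A , x∈T) → T⊥A (x∈T , x∈A)) ∷ []
  coordinate-open A false S (A∉ ∷ []) = record
    { K = λ _ → Empty.⊥ ; K-resp = λ _ () ; K-compact = λ _ _ _ _ → [] , λ ()
    ; Rs = set A ∷ [] ; Rs-open = 𝓦-open A ∷ [] } ,
    ((λ ()) , stable (λ none → not-¬ A∉ (ideal⁺ S A λ (x∈A , x∈S) → none (_ , x∈S , x∈A))) ∷ []) ,
    λ { {T} (_ , (_ , x∈T , x∈A) ∷ []) → ¬-not (λ A∈ → ideal⁻ T A A∈ (x∈A , x∈T)) ∷ [] }

  ideal-Cylinder-open : ∀ abs → Chabauty-top.Open (λ S → ideal S ∈ Cylinder abs)
  ideal-Cylinder-open [] = Chabauty-top.Open-resp-≐ ((λ _ → []) , _) Chabauty-top.Open-⊤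
  ideal-Cylinder-open ((A , b) ∷ abs) = Chabauty-top.Open-resp-≐
    ((λ { ((eq ∷ []) , h) → eq ∷ h }) , (λ { (eq ∷ h) → (eq ∷ []) , h }))
    (Chabauty-top.Open-∩ (coordinate-open A b) (ideal-Cylinder-open abs))

  Γ⁻¹-continuous : Continuous Chabauty CSI-topology Γ⁻¹
  Γ⁻¹-continuous V (U , oU , V⊆U , U⊆V) S S∈V =
    let abs , S∈ , abs⊆U = oU (ideal S) (V⊆U S∈V)
        β , S∈β , β⊆ = ideal-Cylinder-open abs S S∈
    in β , S∈β , λ {T} T∈β → U⊆V {toIdeal T} (abs⊆U (β⊆ {T} T∈β))

  -- Separation and compactness of both spaces.

  CSI-hausdorff : CSI-top.Hausdorff
  CSI-hausdorff J J′ J≉J′ =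
    let A , J≢J′ = stable λ none → J≉J′ λ A → stable λ ≢ → none (A , ≢)
    in _ , _ , Cylinder-open ((A , Func.to (proj₁ J) A) ∷ []) ,
       Cylinder-open ((A , Func.to (proj₁ J′) A) ∷ []) , ≡.refl ∷ [] , ≡.refl ∷ [] ,
       λ { (eq ∷ [] , eq′ ∷ []) → J≢J′ (≡.trans (≡.sym eq) eq′) }

  omitted : ∃[ A ] (∀ J → ¬ (A ∈ⁱ J))
  omitted = let A , ε∈A , _ = basis {x = ε} Open-⊤ _ in A , λ J A∈J → ε∉member J {A} A∈J ε∈A

  -- A point of {0,1}^𝓦 all of whose basic neighbourhoods meet CSI lies in CSI.
  -- Properness passes to the limit because all J ∈ CSI omit a common coset.
  module Limit (F : 𝓦 → Bool)
    (limit : ∀ abs → All (λ (A , b) → F A ≡ b) abs → Σ[ J ∈ Ideal ] proj₁ J ∈ Cylinder abs)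
    where

    -- Conditions on finitely many coordinates pass to the limit: some ideal agrees with `F` both on
    -- `abs` and at `A`, so its forced value at `A` is that of `F`.
    forced : ∀ abs → All (λ (A , b) → F A ≡ b) abs → ∀ A {b} →
             (∀ J → proj₁ J ∈ Cylinder abs → Func.to (proj₁ J) A ≡ b) → F A ≡ b
    forced abs agree A force =
      let J , J∈ = limit ((A , F A) ∷ abs) (≡.refl ∷ agree)
      in ≡.trans (≡.sym (All.head J∈)) (force J (All.tail J∈))

    -- `F` is a bare function; respecting equality in `𝓦` is itself a condition on two coordinates
    -- and so passes to the limit.
    point : Setoid.Carrier 𝒫𝓦
    point = record
      { to   = F
      ; cong = λ {A} {B} A≐B → forced ((B , F B) ∷ []) (≡.refl ∷ []) A λ { J (eq ∷ []) →
          ≡.trans (Func.cong (proj₁ J) {A} {B} A≐B) eq }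
      }

    point-isClosedSubgroupIdeal : IsClosedSubgroupIdeal point
    point-isClosedSubgroupIdeal = record
      { isIdeal   = record
        { ∅-mem    = λ A A≐∅ → forced [] [] A λ (_ , csi) _ → ∅-mem (isIdeal csi) A A≐∅
        ; ∪-closed = λ Bs Bs∈ A A⊆ → forced (List.map (_, true) Bs) (All.map⁺ Bs∈) A λ (_ , csi) h →
            ∪-closed (isIdeal csi) Bs (All.map⁻ h) A A⊆
        }
      ; proper    = λ all →
          let A , A∉ = omitted
              J , J∈ = limit ((A , true) ∷ []) (all A ∷ [])
          in A∉ J (All.head J∈)
      ; ⁻¹-closed = λ A B inv A∈ → forced ((A , true) ∷ []) (A∈ ∷ []) B λ { (_ , csi) (A∈J ∷ []) →
          ⁻¹-closed csi A B inv A∈J }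
      -- A disjunction is not of the form handled by `forced`, so the value at `A` is fixed first;
      -- if it is `false`, the value at `B` is forced.
      ; prime     = λ A B C sat-A sat-B prod C∈ → split (F A) ≡.refl λ A∉ →
          forced ((C , true) ∷ (A , false) ∷ []) (C∈ ∷ A∉ ∷ []) B λ { (_ , csi) (C∈J ∷ A∉J ∷ []) →
            decide A∉J (prime csi A B C sat-A sat-B prod C∈J) }
      }
      where
      split : ∀ b {y} {P : Set y} → {x : Bool} → b ≡ x → (b ≡ false → P) → b ≡ true ⊎ P
      split true  _ _ = inj₁ ≡.refl
      split false _ f = inj₂ (f ≡.refl)

      decide : ∀ {x y} → x ≡ false → x ≡ true ⊎ y ≡ true → y ≡ true
      decide ≡.refl (inj₂ eq) = eq

  module FinitelyManySuffice (I : Set w) (U : I → Pred Ideal w) (oU : ∀ i → CSI-top.Open (U i))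
    (cover : ∀ J → ∃[ i ] J ∈ U i)
    where

    FinitelyCovered : Pred Literals w
    FinitelyCovered abs = ∃[ is ] (∀ J → proj₁ J ∈ Cylinder abs → Any (λ i → J ∈ U i) is)

    FinitelyCovered-⊆ : ∀ {abs abs′} → abs List.⊆ abs′ → FinitelyCovered abs → FinitelyCovered abs′
    FinitelyCovered-⊆ abs⊆ (is , h) = is , λ J J∈ → h J (List.All-resp-⊇ abs⊆ J∈)

    FinitelyCovered-split : ∀ {abs} A → FinitelyCovered ((A , true) ∷ abs) →
                            FinitelyCovered ((A , false) ∷ abs) → FinitelyCovered abs
    FinitelyCovered-split {abs} A (is , h) (js , k) = is ++ js , λ J J∈ → either J J∈ _ ≡.refl
      where
      either : ∀ J → proj₁ J ∈ Cylinder abs → ∀ b → Func.to (proj₁ J) A ≡ b →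
               Any (λ i → J ∈ U i) (is ++ js)
      either J J∈ true  eq = Any.++⁺ˡ (h J (eq ∷ J∈))
      either J J∈ false eq = Any.++⁺ʳ is (k J (eq ∷ J∈))

    uncovered-split : ∀ {abs} A → ¬ FinitelyCovered abs → ∃[ b ] ¬ FinitelyCovered ((A , b) ∷ abs)
    uncovered-split A ¬fin = stable λ none →
      ¬fin (FinitelyCovered-split A (stable λ ¬fin′ → none (_ , ¬fin′)) (stable λ ¬fin′ → none (_ , ¬fin′)))

    -- Otherwise there is an assignment none of whose cylinders is finitely covered. As a limit of
    -- ideals it is an ideal, so some `U i` contains it together with the trace of one of its
    -- cylinders, a cover by one member.
    not-uncovered : ¬ ¬ FinitelyCovered []
    not-uncovered ¬fin =
      let i , J∈U = cover (point , point-isClosedSubgroupIdeal)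
          V , oV , U⊆V , V⊆U = oU i
          abs , J∈ , abs⊆V = oV point (U⊆V J∈U)
      in assignment-consistent abs J∈ (i ∷ [] , λ J J∈ → here (V⊆U (abs⊆V J∈)))
      where
      open TwoValued em ext (λ abs → ¬ FinitelyCovered abs) ¬fin
        (λ abs⊆ ¬fin′ → ¬fin′ ∘ FinitelyCovered-⊆ abs⊆) uncovered-split
      -- A cylinder containing no ideal is covered by the empty subfamily, so every cylinder around
      -- the assignment meets `CSI`.
      open Limit assignment (λ abs agree → stable λ none →
        assignment-consistent abs agree ([] , λ J J∈ → ⊥-elim (none (J , J∈))))

  CSI-compact : CSI-top.Compact {q = w} (λ _ → ⊤)
  CSI-compact I U oU cover =
    let is , h = stable (FinitelyManySuffice.not-uncovered I U oU λ J → cover {J} _) in is , λ {J} _ → h J []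

  CSI-compactHausdorff : CSI-top.CompactHausdorffSpace
  CSI-compactHausdorff = CSI-compact , CSI-hausdorff

  Chabauty-compactHausdorff : Chabauty-top.CompactHausdorffSpace
  Chabauty-compactHausdorff =
    Compact-image {T = CSI-topology} {T′ = Chabauty} {f = Γ} Γ-continuous
      (λ S → toIdeal S , toSubgroup-toIdeal S) CSI-compact ,
    Hausdorff-preimage {T = Chabauty} {T′ = CSI-topology} {f = Γ⁻¹} Γ⁻¹-continuous
      (λ {S} {T} → Γ⁻¹-injective {S} {T}) CSI-hausdorff

proposition7p5 : (∀ {a} → ExcludedMiddle a) → (∀ {a b} → Extensionality a b) →
    ∀ {c ℓ o} (G : TDLCGroup c ℓ o) → let open MeetGroupoid G in
    Σ[ Γ ∈ Func CSI 𝓢 ]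
    (∀ J → carrier (Func.to Γ J) ≐ S⟨ J ⟩) ×
    Topology.CompactHausdorffSpace CSI-topology ×
    Topology.CompactHausdorffSpace Chabauty ×
    Continuous CSI-topology Chabauty Γ ×
    Bijective (Setoid._≈_ CSI) (Setoid._≈_ 𝓢) (Func.to Γ) ×
    Homeomorphism CSI-topology Chabauty Γ
proposition7p5 em ext G =
  Γ ,
  (λ J → uncovered⁻ J , uncovered⁺ J) ,
  CSI-compactHausdorff ,
  Chabauty-compactHausdorff ,
  Γ-continuous ,
  Γ-bijective ,
  (Γ-continuous , Γ⁻¹ , Γ⁻¹-continuous , Γ-inverse)
  where
  open ClosedSubgroupIdeals em ext G
  open ChabautySpace em ext G
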